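{- Suppose there exists an oracle $\mathcal{O}$ which computes an $\epsilon'$-approximate solution to the packing linear program $$\max_{X\in\mathcal{K}(r,c)}\langle B,X\rangle,\qquad \mathcal{K}(r,c):=\{X\in\mathbb{R}_{\ge 0}^{m\times l}: X\mathbf{1}\le r,\ X^T\mathbf{1}\le c\},\qquad B:=\|C\|_{\max}\mathbf{1}\mathbf{1}^T-C,$$ in time $O(\mathcal{T}(m,l,1/\epsilon'))$, where $m$ and $l$ are the dimensions of $r$ and $c$. Then there is an algorithm which computes an $\epsilon$-approximate solution to the optimal transport problem with marginals $r,c\in\Delta^n$ and cost $C\in\mathbb{R}_{\ge 0}^{n\times n}$ in time $$O\left(n^2+\mathcal{T}\left(n,n,\frac{\|C\|_{\max}}{\epsilon}\right)\right).$$
   Context: $\mathbb{R}_{\ge 0}$ is the set of non-negative reals, $\mathbf{1}$ is the all-ones vector, $\Delta^n=\{x\in\mathbb{R}_{\ge 0}^n:\sum_i x_i=1\}$, $\langle A,B\rangle=\sum_{i,j}A_{ij}B_{ij}$, and $\|A\|_{\max}$ is the maximum modulus of an entry of $A$. A packing linear program is $V_*=\max\{d^Tx: x\ge 0,\ Ax\le b\}$ with $A,b,d$ entrywise non-negative; an $\epsilon'$-approximate solution of it is a non-negative $x$ with $Ax\le b$ and $d^Tx\ge(1-\epsilon')V_*$. An instance of the optimal transport problem consists of marginals $r,c\in\Delta^n$ with strictly positive entries and a non-negative cost matrix $C\in\mathbb{R}_{\ge 0}^{n\times n}$; the problem is $\min_{X\in\mathcal{U}(r,c)}\langle C,X\rangle$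 where $\mathcal{U}(r,c)=\{X\in\mathbb{R}_{\ge 0}^{n\times n}: X\mathbf{1}=r,\ X^T\mathbf{1}=c\}$. An $\epsilon$-approximate solution of it is $\widehat{X}\in\mathcal{U}(r,c)$ with $\langle C,\widehat{X}\rangle\le\min_{X\in\mathcal{U}(r,c)}\langle C,X\rangle+\epsilon$. -}

module Defs where

open import Algebra.Bundles using (CommutativeRing)
import Algebra.Construct.NaturalChoice.Max as NaturalMax
import Algebra.Properties.Semiring.Mult as SemiringMult
import Algebra.Properties.Semiring.Sum as SemiringSum
open import Data.Bool.Base using (Bool; true; false; if_then_else_; _∧_)
open import Data.Fin.Base using (Fin; toℕ; fromℕ<)
open import Data.Nat.Base as ℕ using (ℕ; suc; NonZero)
import Data.Nat.Properties as ℕ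
open import Data.Product.Base using (∃; _×_)
open import Data.Vec.Functional using (Vector; foldr)
open import Level using (Level; _⊔_) renaming (suc to lsuc)
open import Relation.Binary.Bundles using (DecTotalOrder)
open import Relation.Binary.Core using (Rel)
open import Relation.Binary.PropositionalEquality.Core using (_≡_)
open import Relation.Binary.Structures using (IsDecTotalOrder)
import Relation.Binary.Construct.NonStrictToStrict as ToStrict
open import Relation.Nullary.Decidable.Core using (yes; no; does)
open import Relation.Nullary.Negation.Core using (¬_)

-- The real numbers, axiomatised as a Dedekind-complete ordered field, which
-- determines them up to unique isomorphism.  The order is decidable, as in
-- classical mathematics.  The value of 0# ⁻¹ is unspecified.

record Reals (c ℓ₁ ℓ₂ : Level) : Set (lsuc (c ⊔ ℓ₁ ⊔ ℓ₂)) where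
  infix  8 _⁻¹
  infixl 7 _/_
  infix  4 _≤_

  field
    commutativeRing : CommutativeRing c ℓ₁

  open CommutativeRing commutativeRing public

  field
    _≤_             : Rel Carrier ℓ₂
    isDecTotalOrder : IsDecTotalOrder _≈_ _≤_
    0≉1             : ¬ (0# ≈ 1#)
    _⁻¹             : Carrier → Carrier
    ⁻¹-inverseʳ     : ∀ x → ¬ (x ≈ 0#) → x * x ⁻¹ ≈ 1#
    +-monoˡ-≤       : ∀ {x y} z → x ≤ y → x + z ≤ y + z
    *-nonNeg        : ∀ {x y} → 0# ≤ x → 0# ≤ y → 0# ≤ x * y
    supremum        : (P : Carrier → Set (c ⊔ ℓ₁ ⊔ ℓ₂)) → ∃ P →
                      (∃ λ u → ∀ x → P x → x ≤ u) →
                      ∃ λ s → (∀ x → P x → x ≤ s) ×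
                              (∀ u → (∀ x → P x → x ≤ u) → s ≤ u)

  decTotalOrder : DecTotalOrder c ℓ₁ ℓ₂
  decTotalOrder = record { isDecTotalOrder = isDecTotalOrder }

  open DecTotalOrder decTotalOrder public using (totalOrder; _≤?_)
  open ToStrict _≈_ _≤_ public using (_<_)
  open NaturalMax totalOrder public renaming (_⊔_ to max) using ()
  open SemiringSum semiring public using (sum)

  _/_ : Carrier → Carrier → Carrier
  x / y = x * y ⁻¹

  ∣_∣ : Carrier → Carrier
  ∣ x ∣ = max x (- x)

  fromℕ : ℕ → Carrier
  fromℕ n = SemiringMult._×_ semiring n 1#

-- Programs of a real random access machine with an oracle.  Memory consists
-- of natural-number registers and two-dimensional arrays of reals, both named
-- by natural numbers.  Registers are used for indexing and loop control only:
-- they can be copied, incremented and compared, but reals cannot be converted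
-- to them.  Programs are finite syntax whose only real constants are 0 and 1,
-- and do not depend on the size of the input.

Register Array : Set
Register = ℕ
Array    = ℕ

data Index : Set where
  lit : ℕ → Index
  reg : Register → Index

data Expr : Set where
  zero one        : Expr
  _[_,_]          : Array → Index → Index → Expr
  _⊕_ _⊖_ _⊗_ _⊘_ : Expr → Expr → Expr

data Test : Set where
  _<ⁱ_ : Index → Index → Test
  _≤ʳ_ : Expr → Expr → Test

infixr 1 _⨾_

data Program : Set where
  skip     : Program
  _≔_      : Register → Index → Program
  inc      : Register → Program
  _[_,_]≔_ : Array → Index → Index → Expr → Program
  _⨾_      : Program → Program → Program
  cond     : Test → Program → Program → Program
  while    : Test → Program → Program
  -- query m l r c B ε X: submit the m × l packing program whose data are in
  -- column 0 of r, column 0 of c, in B, and in ε[0,0]; write the answer to X.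
  query    : (m l : Index) (r c B ε X : Array) → Program

exprCost : Expr → ℕ
exprCost zero         = 1
exprCost one          = 1
exprCost (_ [ _ , _ ]) = 1
exprCost (e ⊕ f)      = suc (exprCost e ℕ.+ exprCost f)
exprCost (e ⊖ f)      = suc (exprCost e ℕ.+ exprCost f)
exprCost (e ⊗ f)      = suc (exprCost e ℕ.+ exprCost f)
exprCost (e ⊘ f)      = suc (exprCost e ℕ.+ exprCost f)

testCost : Test → ℕ
testCost (_ <ⁱ _) = 1
testCost (e ≤ʳ f) = suc (exprCost e ℕ.+ exprCost f)

module OptimalTransport {c ℓ₁ ℓ₂ : Level} (ℝ : Reals c ℓ₁ ℓ₂) where

  open Reals ℝ public

  Matrix : ℕ → ℕ → Set c
  Matrix m l = Fin m → Fin l → Carrier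

  rowSum : ∀ {m l} → Matrix m l → Vector Carrier m
  rowSum X i = sum λ j → X i j

  colSum : ∀ {m l} → Matrix m l → Vector Carrier l
  colSum X j = sum λ i → X i j

  ⟨_,_⟩ : ∀ {m l} → Matrix m l → Matrix m l → Carrier
  ⟨ A , B ⟩ = sum λ i → sum λ j → A i j * B i j

  -- Starting the fold from 0# is harmless, as moduli are non-negative.
  ‖_‖max : ∀ {m l} → Matrix m l → Carrier
  ‖ A ‖max = foldr max 0# λ i → foldr max 0# λ j → ∣ A i j ∣

  NonNegᵛ : ∀ {n} → Vector Carrier n → Set ℓ₂
  NonNegᵛ x = ∀ i → 0# ≤ x i

  NonNegᵐ : ∀ {m l} → Matrix m l → Set ℓ₂
  NonNegᵐ X = ∀ i j → 0# ≤ X i j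

  Simplex : ∀ n → Vector Carrier n → Set (ℓ₁ ⊔ ℓ₂)
  Simplex n x = NonNegᵛ x × sum x ≈ 1#

  IsMaximum : ∀ {a p} {A : Set a} → (A → Set p) → (A → Carrier) → Carrier →
              Set (a ⊔ p ⊔ ℓ₁ ⊔ ℓ₂)
  IsMaximum Feasible f v = (∃ λ x → Feasible x × f x ≈ v) ×
                           (∀ x → Feasible x → f x ≤ v)

  IsMinimum : ∀ {a p} {A : Set a} → (A → Set p) → (A → Carrier) → Carrier →
              Set (a ⊔ p ⊔ ℓ₁ ⊔ ℓ₂)
  IsMinimum Feasible f v = (∃ λ x → Feasible x × f x ≈ v) ×
                           (∀ x → Feasible x → v ≤ f x)

  𝒦 : ∀ {m l} → Vector Carrier m → Vector Carrier l → Matrix m l → Set ℓ₂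
  𝒦 r c X = NonNegᵐ X × (∀ i → rowSum X i ≤ r i) × (∀ j → colSum X j ≤ c j)

  𝒰 : ∀ {n} → Vector Carrier n → Vector Carrier n → Matrix n n → Set (ℓ₁ ⊔ ℓ₂)
  𝒰 r c X = NonNegᵐ X × (∀ i → rowSum X i ≈ r i) × (∀ j → colSum X j ≈ c j)

  ApproxPacking : ∀ {m l} → Vector Carrier m → Vector Carrier l → Matrix m l →
                  Carrier → Matrix m l → Set (c ⊔ ℓ₁ ⊔ ℓ₂)
  ApproxPacking r c B ε X =
    𝒦 r c X ×
    ∃ λ V → IsMaximum (𝒦 r c) (λ Y → ⟨ B , Y ⟩) V × (1# - ε) * V ≤ ⟨ B , X ⟩

  ApproxTransport : ∀ {n} → Vector Carrier n → Vector Carrier n → Matrix n n →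
                    Carrier → Matrix n n → Set (c ⊔ ℓ₁ ⊔ ℓ₂)
  ApproxTransport r c C ε X =
    𝒰 r c X ×
    ∃ λ V → IsMinimum (𝒰 r c) (λ Y → ⟨ C , Y ⟩) V × ⟨ C , X ⟩ ≤ V + ε

  record Oracle : Set c where
    field
      answer : ∀ {m l} → Vector Carrier m → Vector Carrier l → Matrix m l →
               Carrier → Matrix m l
      time   : ∀ {m l} → Vector Carrier m → Vector Carrier l → Matrix m l →
               Carrier → ℕ

  -- The inputs on which the oracle is required to work.  It sees only the
  -- packing program (r, c, B), not the matrix C that B comes from; B is given
  -- up to _≈_ because matrices are functions into a setoid.
  record PackingInput {m l} (r : Vector Carrier m) (c : Vector Carrier l)
                      (C B : Matrix m l) (ε : Carrier) : Set (ℓ₁ ⊔ ℓ₂) where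
    field
      m≢0 : NonZero m
      l≢0 : NonZero l
      r≥0 : NonNegᵛ r
      c≥0 : NonNegᵛ c
      C≥0 : NonNegᵐ C
      B≈  : ∀ i j → B i j ≈ ‖ C ‖max - C i j
      ε>0 : 0# < ε

  -- A running time 𝒯(m, l, x) is a non-negative function of x ≥ 0.
  record IsRunningTime (𝒯 : ℕ → ℕ → Carrier → Carrier) :
                       Set (c ⊔ ℓ₁ ⊔ ℓ₂) where
    field
      cong   : ∀ m l {x y} → x ≈ y → 𝒯 m l x ≈ 𝒯 m l y
      nonNeg : ∀ m l {x} → 0# ≤ x → 0# ≤ 𝒯 m l x

  SolvesPacking : Oracle → Set (c ⊔ ℓ₁ ⊔ ℓ₂)
  SolvesPacking 𝒪 =
    ∀ {m l} (r : Vector Carrier m) (c : Vector Carrier l) (C B : Matrix m l) ε →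
    PackingInput r c C B ε → ApproxPacking r c B ε (Oracle.answer 𝒪 r c B ε)

  RunsInTime : Oracle → (ℕ → ℕ → Carrier → Carrier) → Set (c ⊔ ℓ₁ ⊔ ℓ₂)
  RunsInTime 𝒪 𝒯 = ∃ λ K →
    ∀ {m l} (r : Vector Carrier m) (c : Vector Carrier l) (C B : Matrix m l) ε →
    PackingInput r c C B ε →
    fromℕ (Oracle.time 𝒪 r c B ε) ≤ K * 𝒯 m l (1# / ε)

  record Store : Set c where
    constructor store
    field
      register : Register → ℕ
      array    : Array → ℕ → ℕ → Carrier

  open Store public

  ⟦_⟧ⁱ : Index → Store → ℕ
  ⟦ lit n ⟧ⁱ s = n
  ⟦ reg k ⟧ⁱ s = register s k

  ⟦_⟧ : Expr → Store → Carrier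
  ⟦ zero ⟧        s = 0#
  ⟦ one ⟧         s = 1#
  ⟦ a [ i , j ] ⟧ s = array s a (⟦ i ⟧ⁱ s) (⟦ j ⟧ⁱ s)
  ⟦ e ⊕ f ⟧       s = ⟦ e ⟧ s + ⟦ f ⟧ s
  ⟦ e ⊖ f ⟧       s = ⟦ e ⟧ s - ⟦ f ⟧ s
  ⟦ e ⊗ f ⟧       s = ⟦ e ⟧ s * ⟦ f ⟧ s
  ⟦ e ⊘ f ⟧       s = ⟦ e ⟧ s / ⟦ f ⟧ s

  ⟦_⟧ᵗ : Test → Store → Bool
  ⟦ i <ⁱ j ⟧ᵗ s = does (⟦ i ⟧ⁱ s ℕ.<? ⟦ j ⟧ⁱ s)
  ⟦ e ≤ʳ f ⟧ᵗ s = does (⟦ e ⟧ s ≤? ⟦ f ⟧ s)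

  setRegister : Register → ℕ → Store → Store
  setRegister k n s = record s
    { register = λ k′ → if does (k′ ℕ.≟ k) then n else register s k′ }

  setCell : Array → ℕ → ℕ → Carrier → Store → Store
  setCell a i j x s = record s
    { array = λ a′ i′ j′ →
        if does (a′ ℕ.≟ a) ∧ does (i′ ℕ.≟ i) ∧ does (j′ ℕ.≟ j)
        then x else array s a′ i′ j′ }

  readVector : Store → Array → (n : ℕ) → Vector Carrier n
  readVector s a n i = array s a (toℕ i) 0

  readMatrix : Store → Array → (m l : ℕ) → Matrix m l
  readMatrix s a m l i j = array s a (toℕ i) (toℕ j)

  overwrite : ∀ {m l} → Matrix m l → (ℕ → ℕ → Carrier) → ℕ → ℕ → Carrier
  overwrite {m} {l} X old i j with i ℕ.<? m | j ℕ.<? l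
  ... | yes i<m | yes j<l = X (fromℕ< i<m) (fromℕ< j<l)
  ... | _       | _       = old i j

  writeMatrix : ∀ {m l} → Array → Matrix m l → Store → Store
  writeMatrix a X s = record s
    { array = λ a′ → if does (a′ ℕ.≟ a) then overwrite X (array s a′)
                                        else array s a′ }

  module _ (𝒪 : Oracle) where

    -- Run p s t s′: started in s, p halts in s′ after t steps.  A query costs
    -- one step in addition to the time taken by the oracle.
    data Run : Program → Store → ℕ → Store → Set c where
      skip   : ∀ {s} → Run skip s 0 s
      assign : ∀ {k i s} → Run (k ≔ i) s 1 (setRegister k (⟦ i ⟧ⁱ s) s)
      inc    : ∀ {k s} →
               Run (inc k) s 1 (setRegister k (suc (register s k)) s)
      assignCell : ∀ {a i j e s} →
               Run (a [ i , j ]≔ e) s (suc (exprCost e))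
                   (setCell a (⟦ i ⟧ⁱ s) (⟦ j ⟧ⁱ s) (⟦ e ⟧ s) s)
      seq    : ∀ {p q s s′ s″ t t′} →
               Run p s t s′ → Run q s′ t′ s″ → Run (p ⨾ q) s (t ℕ.+ t′) s″
      cond-true : ∀ {b p q s s′ t} → ⟦ b ⟧ᵗ s ≡ true →
               Run p s t s′ → Run (cond b p q) s (testCost b ℕ.+ t) s′
      cond-false : ∀ {b p q s s′ t} → ⟦ b ⟧ᵗ s ≡ false →
               Run q s t s′ → Run (cond b p q) s (testCost b ℕ.+ t) s′
      while-true : ∀ {b p s s′ s″ t t′} → ⟦ b ⟧ᵗ s ≡ true →
               Run p s t s′ → Run (while b p) s′ t′ s″ →
               Run (while b p) s (testCost b ℕ.+ (t ℕ.+ t′)) s″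
      while-false : ∀ {b p s} → ⟦ b ⟧ᵗ s ≡ false →
               Run (while b p) s (testCost b) s
      query  : ∀ {m l r c B ε X s} →
               let rˢ = readVector s r (⟦ m ⟧ⁱ s)
                   cˢ = readVector s c (⟦ l ⟧ⁱ s)
                   Bˢ = readMatrix s B (⟦ m ⟧ⁱ s) (⟦ l ⟧ⁱ s)
                   εˢ = array s ε 0 0
               in Run (query m l r c B ε X) s
                      (suc (Oracle.time 𝒪 rˢ cˢ Bˢ εˢ))
                      (writeMatrix X (Oracle.answer 𝒪 rˢ cˢ Bˢ εˢ) s)

  record TransportInput {n} (r c : Vector Carrier n) (C : Matrix n n)
                        (ε : Carrier) : Set (ℓ₁ ⊔ ℓ₂) where
    field
      r∈Δ : Simplex n r
      c∈Δ : Simplex n c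
      r>0 : ∀ i → 0# < r i
      c>0 : ∀ i → 0# < c i
      C≥0 : NonNegᵐ C
      ε>0 : 0# < ε

  -- Input convention: n is in register 0, and r, c, C, ε are in arrays 0 to 3.
  -- The rest of the memory may hold anything.
  record Encodes {n} (s : Store) (r c : Vector Carrier n) (C : Matrix n n)
                 (ε : Carrier) : Set ℓ₁ where
    field
      n≡ : register s 0 ≡ n
      r≈ : ∀ i → readVector s 0 n i ≈ r i
      c≈ : ∀ i → readVector s 1 n i ≈ c i
      C≈ : ∀ i j → readMatrix s 2 n n i j ≈ C i j
      ε≈ : array s 3 0 0 ≈ ε

  -- Output convention: the transport plan is in array 4.
  output : Store → (n : ℕ) → Matrix n n
  output s n = readMatrix s 4 n n

  SolvesTransportInTime : Oracle → Program →
                          (∀ {n} → Matrix n n → Carrier → Carrier) →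
                          Set (c ⊔ ℓ₁ ⊔ ℓ₂)
  SolvesTransportInTime 𝒪 p bound = ∃ λ K →
    ∀ {n} (r c : Vector Carrier n) (C : Matrix n n) ε → TransportInput r c C ε →
    ∀ s → Encodes s r c C ε →
    ∃ λ s′ → ∃ λ t → Run 𝒪 p s t s′ ×
                     ApproxTransport r c C ε (output s′ n) ×
                     fromℕ t ≤ K * bound C ε

-- With M = ‖ C ‖max and B = M - C, every transport plan X satisfies
-- ⟨ B , X ⟩ + ⟨ C , X ⟩ = M, since it has total mass 1.  As B ≥ 0, a packing
-- can be padded to a transport plan without lowering ⟨ B , _ ⟩, so that the
-- optimal values V of the packing program and W of the transport problem satisfy
-- W = M - V.  In particular V ≤ M, so that asking the oracle for accuracy ε / M
-- costs at most (ε / M) V ≤ ε.  When M = 0 this accuracy is meaningless, but then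
-- C = 0 and padding the zero matrix suffices.
module Submission where

open import Defs
open import Data.Bool.Base using (true; false; if_then_else_)
open import Data.Fin.Base using (Fin; zero; suc; toℕ; fromℕ<)
open import Data.Fin.Properties using (toℕ<n; toℕ-fromℕ<; toℕ-injective; fromℕ<-toℕ)
open import Data.Nat.Base as ℕ using (ℕ; zero; suc; NonZero; _^_)
import Data.Nat.Properties as ℕ
open import Data.Nat.Solver using (module +-*-Solver)
open import Data.Product.Base using (∃; _×_; _,_; proj₁; proj₂)
open import Data.Sum.Base using (_⊎_; inj₁; inj₂)
open import Data.Vec.Functional using (Vector; foldr)
open import Function.Base using (_∘_)
open import Level using (_⊔_)
open import Relation.Binary.Bundles using (DecTotalOrder)
open import Relation.Binary.PropositionalEquality as ≡ using (_≡_)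
open import Relation.Nullary.Decidable using (yes; no; dec-true; dec-false; _×-dec_)
open import Relation.Nullary.Negation.Core using (¬_; contradiction)
import Algebra.Construct.NaturalChoice.Max as NaturalMax
import Algebra.Properties.Group as GroupProperties
import Algebra.Properties.AbelianGroup as AbelianGroupProperties
import Algebra.Properties.Ring as RingProperties
import Algebra.Properties.Semiring.Mult as SemiringMult
import Algebra.Properties.Semiring.Sum as SemiringSum
import Relation.Binary.Reasoning.PartialOrder as PosetReasoning

-- That the minimum is attained needs no compactness argument: the correctness of the oracle's
-- answer includes a maximiser of the packing program, and padding it gives an optimal plan. The
-- padding is a rank-one correction, so the machine can compute it in O(n²). As `_⁻¹` is not assumed
-- to respect `_≈_`, the divisor found in memory is a parameter of the rounding argument instead of
-- being replaced by the sum that it represents. The cases M = 0 and M > 0 meet in `Roundable`: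
-- every transport plan above the packing is ε-optimal. One rounding phase then serves both. A
-- single constant has to work for every n, so each phase is bounded by a multiple of n². Constant
-- and linear terms are absorbed because n ≥ 1. The oracle's own time is carried along as a separate
-- summand.

-- Arithmetic and finite sums in an ordered field.

module OrderedField {ℓ ℓ₁ ℓ₂} (ℝ : Reals ℓ ℓ₁ ℓ₂) where

  open Reals ℝ hiding (zero)
  open DecTotalOrder decTotalOrder public
    using (poset; total; antisym; ≤-respˡ-≈; ≤-respʳ-≈)
    renaming (refl to ≤-refl; reflexive to ≤-reflexive; trans to ≤-trans; _≟_ to _≈?_)
  open NaturalMax totalOrder public using (x≤x⊔y; x≤y⊔x; ⊔-lub; x≤y⇒x≤z⊔y)
  open GroupProperties +-group public
    using ()
    renaming ( //-rightDividesˡ to x-y+y≈x; ∙-cancelʳ to +-cancelʳ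
             ; ε⁻¹≈ε to -0≈0; ⁻¹-involutive to -‿involutive)
  open AbelianGroupProperties +-abelianGroup public
    using () renaming (⁻¹-∙-comm to -‿+-comm; xyx⁻¹≈y to x+y-x≈y)
  open RingProperties ring public using (-‿distribʳ-*; [y-z]x≈yx-zx)
  open SemiringSum semiring public
    using (sum-cong-≋; sum-replicate-zero; ∑-distrib-+; ∑-comm; *-distribˡ-sum; *-distribʳ-sum)
  open PosetReasoning poset

  x≤y⇒0≤y-x : ∀ {x y} → x ≤ y → 0# ≤ y - x
  x≤y⇒0≤y-x {x} x≤y = ≤-respˡ-≈ (-‿inverseʳ x) (+-monoˡ-≤ (- x) x≤y)

  0≤y-x⇒x≤y : ∀ {x y} → 0# ≤ y - x → x ≤ y
  0≤y-x⇒x≤y {x} {y} 0≤y-x = begin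
    x            ≈⟨ +-identityˡ x ⟨
    0# + x       ≤⟨ +-monoˡ-≤ x 0≤y-x ⟩
    y - x + x    ≈⟨ x-y+y≈x x y ⟩
    y            ∎

  +-monoʳ-≤ : ∀ {x y} z → x ≤ y → z + x ≤ z + y
  +-monoʳ-≤ {x} {y} z x≤y = begin
    z + x  ≈⟨ +-comm z x ⟩
    x + z  ≤⟨ +-monoˡ-≤ z x≤y ⟩
    y + z  ≈⟨ +-comm y z ⟩
    z + y  ∎

  +-mono-≤ : ∀ {x y u v} → x ≤ y → u ≤ v → x + u ≤ y + v
  +-mono-≤ x≤y u≤v = ≤-trans (+-monoˡ-≤ _ x≤y) (+-monoʳ-≤ _ u≤v)

  +-cancelʳ-≤ : ∀ {x y} z → x + z ≤ y + z → x ≤ y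
  +-cancelʳ-≤ {x} {y} z x+z≤y+z = begin
    x              ≈⟨ x+z-z≈x x ⟨
    x + z - z      ≤⟨ +-monoˡ-≤ (- z) x+z≤y+z ⟩
    y + z - z      ≈⟨ x+z-z≈x y ⟩
    y              ∎
    where
    x+z-z≈x : ∀ x → x + z - z ≈ x
    x+z-z≈x x = trans (+-assoc x z (- z)) (trans (+-congˡ (-‿inverseʳ z)) (+-identityʳ x))

  x≤x+y : ∀ {x y} → 0# ≤ y → x ≤ x + y
  x≤x+y {x} 0≤y = ≤-respˡ-≈ (+-identityʳ x) (+-monoʳ-≤ x 0≤y)

  +-nonNeg : ∀ {x y} → 0# ≤ x → 0# ≤ y → 0# ≤ x + y
  +-nonNeg 0≤x 0≤y = ≤-trans 0≤x (x≤x+y 0≤y)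

  0≤x⇒-x≤0 : ∀ {x} → 0# ≤ x → - x ≤ 0#
  0≤x⇒-x≤0 {x} 0≤x = 0≤y-x⇒x≤y (≤-respʳ-≈ (sym (trans (+-identityˡ _) (-‿involutive x))) 0≤x)

  x≤0⇒0≤-x : ∀ {x} → x ≤ 0# → 0# ≤ - x
  x≤0⇒0≤-x x≤0 = ≤-respʳ-≈ (+-identityˡ _) (x≤y⇒0≤y-x x≤0)

  *-monoˡ-≤-nonNeg : ∀ {x y z} → 0# ≤ z → x ≤ y → x * z ≤ y * z
  *-monoˡ-≤-nonNeg {x} {y} {z} 0≤z x≤y =
    0≤y-x⇒x≤y (≤-respʳ-≈ ([y-z]x≈yx-zx z y x) (*-nonNeg (x≤y⇒0≤y-x x≤y) 0≤z))

  *-monoʳ-≤-nonNeg : ∀ {x y z} → 0# ≤ z → x ≤ y → z * x ≤ z * y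
  *-monoʳ-≤-nonNeg {x} {y} {z} 0≤z x≤y = begin
    z * x  ≈⟨ *-comm z x ⟩
    x * z  ≤⟨ *-monoˡ-≤-nonNeg 0≤z x≤y ⟩
    y * z  ≈⟨ *-comm y z ⟩
    z * y  ∎

  0≤1 : 0# ≤ 1#
  0≤1 with total 0# 1#
  ... | inj₁ 0≤1 = 0≤1
  ... | inj₂ 1≤0 = begin
    0#            ≤⟨ *-nonNeg (x≤0⇒0≤-x 1≤0) (x≤0⇒0≤-x 1≤0) ⟩
    - 1# * - 1#   ≈⟨ -‿distribʳ-* (- 1#) 1# ⟨
    - (- 1# * 1#) ≈⟨ -‿cong (*-identityʳ (- 1#)) ⟩
    - - 1#        ≈⟨ -‿involutive 1# ⟩
    1#            ∎

  ⁻¹-inverseˡ : ∀ x → ¬ (x ≈ 0#) → x ⁻¹ * x ≈ 1#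
  ⁻¹-inverseˡ x x≉0 = trans (*-comm (x ⁻¹) x) (⁻¹-inverseʳ x x≉0)

  ≰⇒≥ : ∀ {x y} → ¬ (x ≤ y) → y ≤ x
  ≰⇒≥ {x} {y} x≰y with total x y
  ... | inj₁ x≤y = contradiction x≤y x≰y
  ... | inj₂ y≤x = y≤x

  0<-respʳ-≈ : ∀ {x y} → x ≈ y → 0# < x → 0# < y
  0<-respʳ-≈ x≈y (0≤x , 0≉x) = ≤-respʳ-≈ x≈y 0≤x , λ 0≈y → 0≉x (trans 0≈y (sym x≈y))

  0<x⇒x≉0 : ∀ {x} → 0# < x → ¬ (x ≈ 0#)
  0<x⇒x≉0 (_ , 0≉x) x≈0 = 0≉x (sym x≈0)

  ⁻¹-nonNeg : ∀ {x} → 0# < x → 0# ≤ x ⁻¹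
  ⁻¹-nonNeg {x} 0<x@(0≤x , _) with total 0# (x ⁻¹)
  ... | inj₁ 0≤x⁻¹ = 0≤x⁻¹
  ... | inj₂ x⁻¹≤0 = contradiction (antisym 0≤1 1≤0) 0≉1
    where
    1≤0 : 1# ≤ 0#
    1≤0 = begin
      1#            ≈⟨ ⁻¹-inverseʳ x (0<x⇒x≉0 0<x) ⟨
      x * x ⁻¹      ≤⟨ *-monoʳ-≤-nonNeg 0≤x x⁻¹≤0 ⟩
      x * 0#        ≈⟨ zeroʳ x ⟩
      0#            ∎

  x≉0∧xy≈1⇒y≈x⁻¹ : ∀ {x y} → ¬ (x ≈ 0#) → x * y ≈ 1# → y ≈ x ⁻¹
  x≉0∧xy≈1⇒y≈x⁻¹ {x} {y} x≉0 xy≈1 = begin-equality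
    y               ≈⟨ *-identityˡ y ⟨
    1# * y          ≈⟨ *-congʳ (⁻¹-inverseˡ x x≉0) ⟨
    x ⁻¹ * x * y    ≈⟨ *-assoc (x ⁻¹) x y ⟩
    x ⁻¹ * (x * y)  ≈⟨ *-congˡ xy≈1 ⟩
    x ⁻¹ * 1#       ≈⟨ *-identityʳ (x ⁻¹) ⟩
    x ⁻¹            ∎

  -- Congruence of `_⁻¹` is not an axiom. Away from zero it follows from the uniqueness of inverses.
  ⁻¹-cong : ∀ {x y} → ¬ (x ≈ 0#) → x ≈ y → x ⁻¹ ≈ y ⁻¹
  ⁻¹-cong {x} {y} x≉0 x≈y =
    x≉0∧xy≈1⇒y≈x⁻¹ (x≉0 ∘ trans x≈y) (trans (*-congʳ (sym x≈y)) (⁻¹-inverseʳ x x≉0))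

  x/y*y≈x : ∀ x {y} → ¬ (y ≈ 0#) → x / y * y ≈ x
  x/y*y≈x x {y} y≉0 = trans (*-assoc x (y ⁻¹) y)
    (trans (*-congˡ (⁻¹-inverseˡ y y≉0)) (*-identityʳ x))

  /-positive : ∀ {x y} → 0# < x → 0# < y → 0# < x / y
  /-positive {x} {y} (0≤x , 0≉x) 0<y =
    *-nonNeg 0≤x (⁻¹-nonNeg 0<y) ,
    λ 0≈x/y → 0≉x (trans (sym (zeroˡ y)) (trans (*-congʳ 0≈x/y) (x/y*y≈x x (0<x⇒x≉0 0<y))))

  1/[x/y]≈y/x : ∀ {x y} → 0# < x → 0# < y → 1# / (x / y) ≈ y / x
  1/[x/y]≈y/x {x} {y} 0<x 0<y = trans (*-identityˡ _)
    (sym (x≉0∧xy≈1⇒y≈x⁻¹ (0<x⇒x≉0 (/-positive 0<x 0<y)) (begin-equality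
      x / y * (y * x ⁻¹)  ≈⟨ *-assoc (x / y) y (x ⁻¹) ⟨
      x / y * y * x ⁻¹    ≈⟨ *-congʳ (x/y*y≈x x (0<x⇒x≉0 0<y)) ⟩
      x * x ⁻¹            ≈⟨ ⁻¹-inverseʳ x (0<x⇒x≉0 0<x) ⟩
      1#                  ∎)))

  sum-mono-≤ : ∀ {n} {f g : Vector Carrier n} → (∀ i → f i ≤ g i) → sum f ≤ sum g
  sum-mono-≤ {zero}  f≤g = ≤-refl
  sum-mono-≤ {suc n} f≤g = +-mono-≤ (f≤g zero) (sum-mono-≤ (f≤g ∘ suc))

  sum-nonNeg : ∀ {n} {f : Vector Carrier n} → (∀ i → 0# ≤ f i) → 0# ≤ sum f
  sum-nonNeg {zero}  0≤f = ≤-refl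
  sum-nonNeg {suc n} 0≤f = +-nonNeg (0≤f zero) (sum-nonNeg (0≤f ∘ suc))

  term≤sum : ∀ {n} {f : Vector Carrier n} → (∀ i → 0# ≤ f i) → ∀ i → f i ≤ sum f
  term≤sum 0≤f zero    = x≤x+y (sum-nonNeg (0≤f ∘ suc))
  term≤sum {suc n} {f} 0≤f (suc i) = begin
    f (suc i)             ≤⟨ term≤sum (0≤f ∘ suc) i ⟩
    sum (f ∘ suc)         ≤⟨ x≤x+y (0≤f zero) ⟩
    sum (f ∘ suc) + f zero ≈⟨ +-comm _ _ ⟩
    sum f                 ∎

  fromℕ-nonNeg : ∀ n → 0# ≤ fromℕ n
  fromℕ-nonNeg zero    = ≤-refl
  fromℕ-nonNeg (suc n) = +-nonNeg 0≤1 (fromℕ-nonNeg n)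

  fromℕ-homo-+ : ∀ m n → fromℕ (m ℕ.+ n) ≈ fromℕ m + fromℕ n
  fromℕ-homo-+ = SemiringMult.×-homo-+ semiring 1#

  fromℕ-homo-* : ∀ m n → fromℕ (m ℕ.* n) ≈ fromℕ m * fromℕ n
  fromℕ-homo-* m n = begin-equality
    fromℕ (m ℕ.* n)       ≈⟨ SemiringMult.×-assocˡ semiring 1# m n ⟨
    m · fromℕ n           ≈⟨ ×-congʳ m (*-identityˡ (fromℕ n)) ⟨
    m · (1# * fromℕ n)    ≈⟨ SemiringMult.×-assoc-* semiring m 1# (fromℕ n) ⟨
    fromℕ m * fromℕ n     ∎
    where open SemiringMult semiring using (×-congʳ) renaming (_×_ to infixl 7 _·_)

  fromℕ-mono-≤ : ∀ {m n} → m ℕ.≤ n → fromℕ m ≤ fromℕ n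
  fromℕ-mono-≤ {n = n} ℕ.z≤n = fromℕ-nonNeg n
  fromℕ-mono-≤ (ℕ.s≤s m≤n) = +-monoʳ-≤ 1# (fromℕ-mono-≤ m≤n)

-- The maximum norm, and padding a packing to a transport plan.

module Rounding {ℓ ℓ₁ ℓ₂} (ℝ : Reals ℓ ℓ₁ ℓ₂) where

  open OptimalTransport ℝ hiding (zero)
  open OrderedField ℝ
  open PosetReasoning poset

  ∣x∣≤y : ∀ {x y} → 0# ≤ x → x ≤ y → ∣ x ∣ ≤ y
  ∣x∣≤y 0≤x x≤y = ⊔-lub x≤y (≤-trans (0≤x⇒-x≤0 0≤x) (≤-trans 0≤x x≤y))

  entry≤foldr-max : ∀ {n} (f : Vector Carrier n) i → f i ≤ foldr max 0# f
  entry≤foldr-max f zero    = x≤x⊔y _ _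
  entry≤foldr-max f (suc i) = x≤y⇒x≤z⊔y _ (entry≤foldr-max (f ∘ suc) i)

  foldr-max-lub : ∀ {n} (f : Vector Carrier n) {u} → 0# ≤ u → (∀ i → f i ≤ u) →
                  foldr max 0# f ≤ u
  foldr-max-lub {zero}  f 0≤u f≤u = 0≤u
  foldr-max-lub {suc n} f 0≤u f≤u =
    ⊔-lub (f≤u zero) (foldr-max-lub (f ∘ suc) 0≤u (f≤u ∘ suc))

  entry≤‖‖max : ∀ {m l} (A : Matrix m l) i j → A i j ≤ ‖ A ‖max
  entry≤‖‖max A i j =
    ≤-trans (x≤x⊔y _ _)
      (≤-trans (entry≤foldr-max (λ j → ∣ A i j ∣) j)
               (entry≤foldr-max (λ i → foldr max 0# λ j → ∣ A i j ∣) i))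

  ‖‖max-nonNeg : ∀ {m l} (A : Matrix m l) → 0# ≤ ‖ A ‖max
  ‖‖max-nonNeg A = foldr-max-nonNeg λ i → foldr max 0# λ j → ∣ A i j ∣
    where
    foldr-max-nonNeg : ∀ {n} (f : Vector Carrier n) → 0# ≤ foldr max 0# f
    foldr-max-nonNeg {zero}  f = ≤-refl
    foldr-max-nonNeg {suc n} f = x≤y⇒x≤z⊔y _ (foldr-max-nonNeg (f ∘ suc))

  ‖‖max-lub : ∀ {m l} (A : Matrix m l) {u} → NonNegᵐ A → 0# ≤ u →
              (∀ i j → A i j ≤ u) → ‖ A ‖max ≤ u
  ‖‖max-lub A A≥0 0≤u A≤u =
    foldr-max-lub _ 0≤u λ i → foldr-max-lub _ 0≤u λ j → ∣x∣≤y (A≥0 i j) (A≤u i j)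

  ⟨⟩-mono-≤ : ∀ {m l} (B : Matrix m l) {X Y : Matrix m l} → NonNegᵐ B →
              (∀ i j → X i j ≤ Y i j) → ⟨ B , X ⟩ ≤ ⟨ B , Y ⟩
  ⟨⟩-mono-≤ B B≥0 X≤Y =
    sum-mono-≤ λ i → sum-mono-≤ λ j → *-monoʳ-≤-nonNeg (B≥0 i j) (X≤Y i j)

  ⟨⟩-nonNeg : ∀ {m l} {A X : Matrix m l} → NonNegᵐ A → NonNegᵐ X → 0# ≤ ⟨ A , X ⟩
  ⟨⟩-nonNeg A≥0 X≥0 = sum-nonNeg λ i → sum-nonNeg λ j → *-nonNeg (A≥0 i j) (X≥0 i j)

  𝒦-cong : ∀ {m l} {r r′ : Vector Carrier m} {c c′ : Vector Carrier l} {X X′} →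
           (∀ i → r i ≈ r′ i) → (∀ j → c j ≈ c′ j) → (∀ i j → X i j ≈ X′ i j) →
           𝒦 r c X → 𝒦 r′ c′ X′
  𝒦-cong r≈r′ c≈c′ X≈X′ (X≥0 , rows , cols) =
    (λ i j → ≤-respʳ-≈ (X≈X′ i j) (X≥0 i j)) ,
    (λ i → ≤-respʳ-≈ (r≈r′ i) (≤-respˡ-≈ (sum-cong-≋ (X≈X′ i)) (rows i))) ,
    (λ j → ≤-respʳ-≈ (c≈c′ j) (≤-respˡ-≈ (sum-cong-≋ λ i → X≈X′ i j) (cols j)))

  -- The oracle is called on marginals read from memory, which agree with the given ones only up to
  -- `_≈_`. `B` stays fixed, since the reduction accepts any matrix that is entrywise `_≈_` to M -
  -- C.
  ApproxPacking-cong : ∀ {m l} {r r′ : Vector Carrier m} {c c′ : Vector Carrier l} {B ε X} →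
                       (∀ i → r i ≈ r′ i) → (∀ j → c j ≈ c′ j) →
                       ApproxPacking r c B ε X → ApproxPacking r′ c′ B ε X
  ApproxPacking-cong r≈r′ c≈c′ (X∈𝒦 , V , ((Y , Y∈𝒦 , ⟨B,Y⟩≈V) , V-max) , near) =
    𝒦-cong r≈r′ c≈c′ (λ _ _ → refl) X∈𝒦 , V ,
    ((Y , 𝒦-cong r≈r′ c≈c′ (λ _ _ → refl) Y∈𝒦 , ⟨B,Y⟩≈V) ,
     λ Z Z∈𝒦 → V-max Z (𝒦-cong (sym ∘ r≈r′) (sym ∘ c≈c′) (λ _ _ → refl) Z∈𝒦)) ,
    near

  𝒰⊆𝒦 : ∀ {n} {r c : Vector Carrier n} {X} → 𝒰 r c X → 𝒦 r c X
  𝒰⊆𝒦 (X≥0 , rows , cols) = X≥0 , ≤-reflexive ∘ rows , ≤-reflexive ∘ cols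

  -- Spreading the unmet demands a and b over X by the rank-one matrix a bᵀ / s
  -- meets all demands.  When s ≈ 0 the demands vanish, so that the unspecified
  -- value of s ⁻¹ is harmless.
  module _ {n} {r c : Vector Carrier n} (Σr≈Σc : sum r ≈ sum c)
           {X : Matrix n n} (X∈𝒦 : 𝒦 r c X)
           (a b : Vector Carrier n) (s : Carrier)
           (a≈ : ∀ i → a i ≈ r i - rowSum X i) (b≈ : ∀ j → b j ≈ c j - colSum X j)
           (s≈ : s ≈ sum a)
           (X̂ : Matrix n n) (X̂≈ : ∀ i j → X̂ i j ≈ X i j + a i * b j / s) where

    private
      a≥0 : NonNegᵛ a
      a≥0 i = ≤-respʳ-≈ (sym (a≈ i)) (x≤y⇒0≤y-x (proj₁ (proj₂ X∈𝒦) i))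

      b≥0 : NonNegᵛ b
      b≥0 j = ≤-respʳ-≈ (sym (b≈ j)) (x≤y⇒0≤y-x (proj₂ (proj₂ X∈𝒦) j))

      a+row≈r : ∀ i → a i + rowSum X i ≈ r i
      a+row≈r i = trans (+-congʳ (a≈ i)) (x-y+y≈x _ _)

      b+col≈c : ∀ j → b j + colSum X j ≈ c j
      b+col≈c j = trans (+-congʳ (b≈ j)) (x-y+y≈x _ _)

      -- Adding up `X` by rows or by columns gives the same mass, so rows and columns lack the same
      -- amount, and one divisor normalises both.
      Σb≈s : sum b ≈ s
      Σb≈s = +-cancelʳ (sum (colSum X)) _ _ (begin-equality
        sum b + sum (colSum X)        ≈⟨ ∑-distrib-+ b (colSum X) ⟨
        sum (λ j → b j + colSum X j)  ≈⟨ sum-cong-≋ b+col≈c ⟩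
        sum c                         ≈⟨ Σr≈Σc ⟨
        sum r                         ≈⟨ sum-cong-≋ a+row≈r ⟨
        sum (λ i → a i + rowSum X i)  ≈⟨ ∑-distrib-+ a (rowSum X) ⟩
        sum a + sum (rowSum X)        ≈⟨ +-cong (sym s≈) (∑-comm X) ⟩
        s + sum (colSum X)            ∎)

      s≥0 : 0# ≤ s
      s≥0 = ≤-respʳ-≈ (sym s≈) (sum-nonNeg a≥0)

      absorb : ∀ {x} → 0# ≤ x → x ≤ s → x * s / s ≈ x
      absorb {x} 0≤x x≤s with 0# ≈? s
      ... | no 0≉s = begin-equality
        x * s / s        ≈⟨ *-assoc x s (s ⁻¹) ⟩
        x * (s * s ⁻¹)   ≈⟨ *-congˡ (⁻¹-inverseʳ s (0≉s ∘ sym)) ⟩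
        x * 1#           ≈⟨ *-identityʳ x ⟩
        x                ∎
      ... | yes 0≈s = begin-equality
        x * s / s        ≈⟨ *-congʳ (*-congˡ 0≈s) ⟨
        x * 0# / s       ≈⟨ *-congʳ (zeroʳ x) ⟩
        0# / s           ≈⟨ zeroˡ (s ⁻¹) ⟩
        0#               ≈⟨ antisym 0≤x (≤-respʳ-≈ (sym 0≈s) x≤s) ⟩
        x                ∎

      a≤s : ∀ i → a i ≤ s
      a≤s i = ≤-respʳ-≈ (sym s≈) (term≤sum a≥0 i)

      b≤s : ∀ j → b j ≤ s
      b≤s j = ≤-respʳ-≈ Σb≈s (term≤sum b≥0 j)

      ab/s≥0 : ∀ i j → 0# ≤ a i * b j / s
      ab/s≥0 i j with 0# ≈? s
      ... | no 0≉s = *-nonNeg (*-nonNeg (a≥0 i) (b≥0 j)) (⁻¹-nonNeg (s≥0 , 0≉s))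
      ... | yes 0≈s = ≤-reflexive (begin-equality
        0#              ≈⟨ zeroˡ (s ⁻¹) ⟨
        0# / s          ≈⟨ *-congʳ (zeroˡ (b j)) ⟨
        0# * b j / s    ≈⟨ *-congʳ (*-congʳ (antisym (a≥0 i) (≤-respʳ-≈ (sym 0≈s) (a≤s i)))) ⟩
        a i * b j / s   ∎)

      rows : ∀ i → rowSum X̂ i ≈ r i
      rows i = begin-equality
        rowSum X̂ i                                ≈⟨ sum-cong-≋ (X̂≈ i) ⟩
        sum (λ j → X i j + a i * b j / s)          ≈⟨ ∑-distrib-+ (X i) _ ⟩
        rowSum X i + sum (λ j → a i * b j / s)     ≈⟨ +-congˡ (*-distribʳ-sum (s ⁻¹) (λ j → a i * b j)) ⟨
        rowSum X i + sum (λ j → a i * b j) / s     ≈⟨ +-congˡ (*-congʳ (*-distribˡ-sum (a i) b)) ⟨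
        rowSum X i + a i * sum b / s               ≈⟨ +-congˡ (*-congʳ (*-congˡ Σb≈s)) ⟩
        rowSum X i + a i * s / s                   ≈⟨ +-congˡ (absorb (a≥0 i) (a≤s i)) ⟩
        rowSum X i + a i                           ≈⟨ +-comm _ _ ⟩
        a i + rowSum X i                           ≈⟨ a+row≈r i ⟩
        r i                                        ∎

      cols : ∀ j → colSum X̂ j ≈ c j
      cols j = begin-equality
        colSum X̂ j                                ≈⟨ sum-cong-≋ (λ i → X̂≈ i j) ⟩
        sum (λ i → X i j + a i * b j / s)          ≈⟨ ∑-distrib-+ (λ i → X i j) _ ⟩
        colSum X j + sum (λ i → a i * b j / s)     ≈⟨ +-congˡ (*-distribʳ-sum (s ⁻¹) (λ i → a i * b j)) ⟨
        colSum X j + sum (λ i → a i * b j) / s     ≈⟨ +-congˡ (*-congʳ (*-distribʳ-sum (b j) a)) ⟨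
        colSum X j + sum a * b j / s               ≈⟨ +-congˡ (*-congʳ (*-congʳ s≈)) ⟨
        colSum X j + s * b j / s                   ≈⟨ +-congˡ (*-congʳ (*-comm s (b j))) ⟩
        colSum X j + b j * s / s                   ≈⟨ +-congˡ (absorb (b≥0 j) (b≤s j)) ⟩
        colSum X j + b j                           ≈⟨ +-comm _ _ ⟩
        b j + colSum X j                           ≈⟨ b+col≈c j ⟩
        c j                                        ∎

    X≤rounded : ∀ i j → X i j ≤ X̂ i j
    X≤rounded i j = ≤-respʳ-≈ (sym (X̂≈ i j)) (x≤x+y (ab/s≥0 i j))

    rounded∈𝒰 : 𝒰 r c X̂
    rounded∈𝒰 = (λ i j → ≤-trans (proj₁ X∈𝒦 i j) (X≤rounded i j)) , rows , cols

  -- Serves the analysis only, where it pads a maximiser. The rounding done by the program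
  -- instantiates the same construction with the contents of memory.
  extension : ∀ {n} {r c : Vector Carrier n} → sum r ≈ sum c → ∀ {X} → 𝒦 r c X →
              ∃ λ X̂ → 𝒰 r c X̂ × (∀ i j → X i j ≤ X̂ i j)
  extension {n} {r} {c} Σr≈Σc {X} X∈𝒦 = X̂ ,
    rounded∈𝒰 Σr≈Σc X∈𝒦 a b s (λ _ → refl) (λ _ → refl) refl X̂ (λ _ _ → refl) ,
    X≤rounded Σr≈Σc X∈𝒦 a b s (λ _ → refl) (λ _ → refl) refl X̂ (λ _ _ → refl)
    where
    a = λ i → r i - rowSum X i
    b = λ j → c j - colSum X j
    s = sum a
    X̂ : Matrix n n
    X̂ i j = X i j + a i * b j / s

  -- From approximate packings to approximate transport plans.

  -- The contract between packing and rounding. It mentions neither `B` nor the oracle, so that it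
  -- also covers the branch in which no query is made.
  record Roundable {n} (r c : Vector Carrier n) (C : Matrix n n) (ε : Carrier)
                   (X : Matrix n n) : Set (ℓ ⊔ ℓ₁ ⊔ ℓ₂) where
    field
      packs   : 𝒦 r c X
      optimal : ∀ {X̂} → 𝒰 r c X̂ → (∀ i j → X i j ≤ X̂ i j) → ApproxTransport r c C ε X̂

  Roundable-cong : ∀ {n} {r c : Vector Carrier n} {C ε X X′} → (∀ i j → X i j ≈ X′ i j) →
                   Roundable r c C ε X → Roundable r c C ε X′
  Roundable-cong X≈X′ roundable = record
    { packs   = 𝒦-cong (λ _ → refl) (λ _ → refl) X≈X′ packs
    ; optimal = λ X̂∈𝒰 X′≤X̂ → optimal X̂∈𝒰 λ i j → ≤-respˡ-≈ (sym (X≈X′ i j)) (X′≤X̂ i j)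
    }
    where open Roundable roundable

  module _ {n} {r c : Vector Carrier n} {C : Matrix n n} {ε : Carrier}
           (input : TransportInput r c C ε) where

    open TransportInput input

    private
      M : Carrier
      M = ‖ C ‖max

      Σr≈Σc : sum r ≈ sum c
      Σr≈Σc = trans (proj₂ r∈Δ) (sym (proj₂ c∈Δ))

    module _ {B : Matrix n n} (B≈ : ∀ i j → B i j ≈ M - C i j) where

      ⟨B⟩+⟨C⟩≈M : ∀ {X} → 𝒰 r c X → ⟨ B , X ⟩ + ⟨ C , X ⟩ ≈ M
      ⟨B⟩+⟨C⟩≈M {X} (_ , rows , _) = begin-equality
        ⟨ B , X ⟩ + ⟨ C , X ⟩
          ≈⟨ ∑-distrib-+ (λ i → sum λ j → B i j * X i j) _ ⟨
        sum (λ i → sum (λ j → B i j * X i j) + sum (λ j → C i j * X i j))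
          ≈⟨ sum-cong-≋ (λ i → ∑-distrib-+ (λ j → B i j * X i j) _) ⟨
        sum (λ i → sum λ j → B i j * X i j + C i j * X i j)
          ≈⟨ sum-cong-≋ (λ i → sum-cong-≋ λ j → entry i j) ⟩
        sum (λ i → sum λ j → M * X i j)
          ≈⟨ sum-cong-≋ (λ i → *-distribˡ-sum M (X i)) ⟨
        sum (λ i → M * rowSum X i)
          ≈⟨ *-distribˡ-sum M (rowSum X) ⟨
        M * sum (rowSum X)
          ≈⟨ *-congˡ (sum-cong-≋ rows) ⟩
        M * sum r
          ≈⟨ *-congˡ (proj₂ r∈Δ) ⟩
        M * 1#
          ≈⟨ *-identityʳ M ⟩
        M ∎
        where
        entry : ∀ i j → B i j * X i j + C i j * X i j ≈ M * X i j
        entry i j = trans (sym (distribʳ (X i j) (B i j) (C i j)))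
                          (*-congʳ (trans (+-congʳ (B≈ i j)) (x-y+y≈x _ _)))

      -- Padding a maximiser of the packing program to a transport plan keeps it
      -- a maximiser, which shows that the transport problem attains M - V.
      packing⇒roundable : ∀ {ε′ X} → 0# ≤ ε′ → ε′ * M ≤ ε →
                          ApproxPacking r c B ε′ X → Roundable r c C ε X
      packing⇒roundable {ε′} {X} 0≤ε′ ε′M≤ε
        (X∈𝒦 , V , ((Y , Y∈𝒦 , ⟨B,Y⟩≈V) , V-max) , near) =
        record { packs = X∈𝒦 ; optimal = optimal }
        where
        B≥0 : NonNegᵐ B
        B≥0 i j = ≤-respʳ-≈ (sym (B≈ i j)) (x≤y⇒0≤y-x (entry≤‖‖max C i j))

        ⟨C⟩≈ : ∀ {Z} → 𝒰 r c Z → ⟨ C , Z ⟩ ≈ M - ⟨ B , Z ⟩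
        ⟨C⟩≈ {Z} Z∈𝒰 = trans (sym (x+y-x≈y ⟨ B , Z ⟩ ⟨ C , Z ⟩)) (+-congʳ (⟨B⟩+⟨C⟩≈M Z∈𝒰))

        V≤M : V ≤ M
        V≤M with extension Σr≈Σc Y∈𝒦
        ... | Ŷ , Ŷ∈𝒰 , Y≤Ŷ = begin
          V                      ≈⟨ ⟨B,Y⟩≈V ⟨
          ⟨ B , Y ⟩              ≤⟨ ⟨⟩-mono-≤ B B≥0 Y≤Ŷ ⟩
          ⟨ B , Ŷ ⟩              ≤⟨ x≤x+y (⟨⟩-nonNeg C≥0 (proj₁ Ŷ∈𝒰)) ⟩
          ⟨ B , Ŷ ⟩ + ⟨ C , Ŷ ⟩  ≈⟨ ⟨B⟩+⟨C⟩≈M Ŷ∈𝒰 ⟩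
          M                      ∎

        minimum : IsMinimum (𝒰 r c) (λ Z → ⟨ C , Z ⟩) (M - V)
        minimum with extension Σr≈Σc Y∈𝒦
        ... | Ŷ , Ŷ∈𝒰 , Y≤Ŷ =
          (Ŷ , Ŷ∈𝒰 , trans (⟨C⟩≈ Ŷ∈𝒰) (+-congˡ (-‿cong
            (antisym (V-max Ŷ (𝒰⊆𝒦 Ŷ∈𝒰))
                     (≤-respˡ-≈ ⟨B,Y⟩≈V (⟨⟩-mono-≤ B B≥0 Y≤Ŷ)))))) ,
          -- A plan is itself a packing, so `V` bounds its value from above; complementing in M
          -- turns this into a lower bound on its cost.
          λ Z Z∈𝒰 → +-cancelʳ-≤ V (begin
            M - V + V              ≈⟨ x-y+y≈x V M ⟩
            M                      ≈⟨ ⟨B⟩+⟨C⟩≈M Z∈𝒰 ⟨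
            ⟨ B , Z ⟩ + ⟨ C , Z ⟩  ≤⟨ +-monoˡ-≤ _ (V-max Z (𝒰⊆𝒦 Z∈𝒰)) ⟩
            V + ⟨ C , Z ⟩          ≈⟨ +-comm V _ ⟩
            ⟨ C , Z ⟩ + V          ∎)

        -- Splitting 1 into `1# - ε′` and `ε′` is sound also for `ε′` above 1, which occurs as soon
        -- as ε exceeds M.
        V≤⟨B,X⟩+ε : V ≤ ⟨ B , X ⟩ + ε
        V≤⟨B,X⟩+ε = begin
          V                          ≈⟨ *-identityˡ V ⟨
          1# * V                     ≈⟨ *-congʳ (x-y+y≈x ε′ 1#) ⟨
          (1# - ε′ + ε′) * V         ≈⟨ distribʳ V (1# - ε′) ε′ ⟩
          (1# - ε′) * V + ε′ * V     ≤⟨ +-mono-≤ near (*-monoʳ-≤-nonNeg 0≤ε′ V≤M) ⟩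
          ⟨ B , X ⟩ + ε′ * M         ≤⟨ +-monoʳ-≤ _ ε′M≤ε ⟩
          ⟨ B , X ⟩ + ε              ∎

        optimal : ∀ {X̂} → 𝒰 r c X̂ → (∀ i j → X i j ≤ X̂ i j) → ApproxTransport r c C ε X̂
        optimal {X̂} X̂∈𝒰 X≤X̂ = X̂∈𝒰 , M - V , minimum , +-cancelʳ-≤ ⟨ B , X̂ ⟩ (begin
          ⟨ C , X̂ ⟩ + ⟨ B , X̂ ⟩       ≈⟨ +-comm _ _ ⟩
          ⟨ B , X̂ ⟩ + ⟨ C , X̂ ⟩       ≈⟨ ⟨B⟩+⟨C⟩≈M X̂∈𝒰 ⟩
          M                            ≈⟨ x-y+y≈x V M ⟨
          M - V + V                    ≤⟨ +-monoʳ-≤ _ V≤⟨B,X⟩+ε ⟩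
          M - V + (⟨ B , X ⟩ + ε)      ≤⟨ +-monoʳ-≤ _ (+-monoˡ-≤ ε (⟨⟩-mono-≤ B B≥0 X≤X̂)) ⟩
          M - V + (⟨ B , X̂ ⟩ + ε)     ≈⟨ +-congˡ (+-comm _ ε) ⟩
          M - V + (ε + ⟨ B , X̂ ⟩)     ≈⟨ +-assoc _ ε _ ⟨
          M - V + ε + ⟨ B , X̂ ⟩       ∎)

    zero-roundable : M ≤ 0# → ∀ {X} → (∀ i j → X i j ≈ 0#) → Roundable r c C ε X
    zero-roundable M≤0 {X} X≈0 = record
      { packs   = (λ i j → ≤-reflexive (sym (X≈0 i j)))
                , (λ i → row≤ (X≈0 i) (proj₁ r∈Δ i))
                , (λ j → row≤ (λ i → X≈0 i j) (proj₁ c∈Δ j))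
      ; optimal = λ {X̂} X̂∈𝒰 _ →
          -- All plans cost zero here, so the plan at hand is its own witness that the minimum is
          -- attained.
          X̂∈𝒰 , 0# , ((X̂ , X̂∈𝒰 , ⟨C⟩≈0 X̂∈𝒰) , λ Z Z∈𝒰 → ≤-reflexive (sym (⟨C⟩≈0 Z∈𝒰))) ,
          ≤-trans (≤-reflexive (⟨C⟩≈0 X̂∈𝒰)) (+-nonNeg ≤-refl (proj₁ ε>0))
      }
      where
      sum≈0 : ∀ {m} {f : Vector Carrier m} → (∀ i → f i ≈ 0#) → sum f ≈ 0#
      sum≈0 {m} f≈0 = trans (sum-cong-≋ f≈0) (sum-replicate-zero m)

      row≤ : ∀ {f : Vector Carrier n} {x} → (∀ i → f i ≈ 0#) → 0# ≤ x → sum f ≤ x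
      row≤ f≈0 = ≤-respˡ-≈ (sym (sum≈0 f≈0))

      ⟨C⟩≈0 : ∀ {Z} → 𝒰 r c Z → ⟨ C , Z ⟩ ≈ 0#
      ⟨C⟩≈0 {Z} _ = sum≈0 λ i → sum≈0 λ j →
        trans (*-congʳ (antisym (≤-trans (entry≤‖‖max C i j) M≤0) (C≥0 i j))) (zeroˡ (Z i j))

-- Loops, their order of traversal and their cost.

for : Register → Program → Program
for k p = k ≔ lit 0 ⨾ while (reg k <ⁱ reg 0) (p ⨾ inc k)

fill : Array → Expr → Program
fill a e = for 1 (for 2 (a [ reg 1 , reg 2 ]≔ e))

-- The cells that a row-major double loop has visited on reaching (i, j). Natural numbers rather
-- than `Fin` allow the one-past-the-end positions that occur when a loop stops.
Before : ℕ → ℕ → ℕ → ℕ → Set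
Before i j i′ j′ = i′ ℕ.< i ⊎ (i′ ≡ i × j′ ℕ.< j)

before-sucʳ : ∀ {i j i′ j′} → Before i (suc j) i′ j′ → ¬ (i′ ≡ i × j′ ≡ j) → Before i j i′ j′
before-sucʳ (inj₁ i′<i)            _ = inj₁ i′<i
before-sucʳ (inj₂ (i′≡i , j′<1+j)) ≢ =
  inj₂ (i′≡i , ℕ.≤∧≢⇒< (ℕ.s≤s⁻¹ j′<1+j) (≢ ∘ (i′≡i ,_)))

-- The start of row i + 1 is the end of row i. The bound on `j′` is required because the end of row
-- i covers only columns below n.
before-sucˡ : ∀ {n i i′ j′} → j′ ℕ.< n → Before (suc i) 0 i′ j′ → Before i n i′ j′
before-sucˡ j′<n (inj₁ i′<1+i) with ℕ.m≤n⇒m<n∨m≡n (ℕ.s≤s⁻¹ i′<1+i)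
... | inj₁ i′<i = inj₁ i′<i
... | inj₂ i′≡i = inj₂ (i′≡i , j′<n)

not-before : ∀ {i′ j′} → ¬ Before 0 0 i′ j′
not-before (inj₁ ())
not-before (inj₂ (_ , ()))

-- The cost of an outer loop with overhead a around an inner loop of cost n b: since n ≥ 1, the
-- overhead is at most n a.
n*[a+n*b]≤[a+b]*n² : ∀ a b n .{{_ : NonZero n}} → n ℕ.* (a ℕ.+ n ℕ.* b) ℕ.≤ (a ℕ.+ b) ℕ.* n ^ 2
n*[a+n*b]≤[a+b]*n² a b n = begin
  n ℕ.* (a ℕ.+ n ℕ.* b)        ≤⟨ ℕ.*-monoʳ-≤ n (ℕ.+-monoˡ-≤ (n ℕ.* b) (ℕ.m≤n*m a n)) ⟩
  n ℕ.* (n ℕ.* a ℕ.+ n ℕ.* b)  ≡⟨ solve 3 (λ a b n →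
    n :* (n :* a :+ n :* b) := (a :+ b) :* (n :* (n :* con 1))) ≡.refl a b n ⟩
  (a ℕ.+ b) ℕ.* n ^ 2          ∎
  where
  open ℕ.≤-Reasoning
  open +-*-Solver

a≤a*n² : ∀ a n .{{_ : NonZero n}} → a ℕ.≤ a ℕ.* n ^ 2
a≤a*n² a n = ℕ.m≤m*n a (n ^ 2) {{ℕ.m^n≢0 n 2}}

a+b*n²≤[a+b]*n² : ∀ a b n .{{_ : NonZero n}} → a ℕ.+ b ℕ.* n ^ 2 ℕ.≤ (a ℕ.+ b) ℕ.* n ^ 2
a+b*n²≤[a+b]*n² a b n = ℕ.≤-trans (ℕ.+-monoˡ-≤ _ (a≤a*n² a n))
                          (ℕ.≤-reflexive (≡.sym (ℕ.*-distribʳ-+ (n ^ 2) a b)))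

-- A program logic for total correctness with time bounds.

module Execution {ℓ ℓ₁ ℓ₂} (ℝ : Reals ℓ ℓ₁ ℓ₂) (𝒪 : OptimalTransport.Oracle ℝ) where

  open OptimalTransport ℝ hiding (zero; refl; sym; trans)

  Memory : Set ℓ
  Memory = Array → ℕ → ℕ → Carrier

  -- Bounding the time instead of fixing it lets branches of different lengths satisfy one
  -- specification.
  Halts : ∀ {q} → Program → Store → ℕ → (Store → Set q) → Set (ℓ ⊔ q)
  Halts p s T Q = ∃ λ s′ → ∃ λ t → Run 𝒪 p s t s′ × t ℕ.≤ T × Q s′

  module _ {q} {Q : Store → Set q} where

    halts-weaken : ∀ {r} {R : Store → Set r} {p s T U} → T ℕ.≤ U → (∀ {s′} → Q s′ → R s′) →
                   Halts p s T Q → Halts p s U R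
    halts-weaken T≤U Q⇒R (s′ , t , run , t≤T , Qs′) = s′ , t , run , ℕ.≤-trans t≤T T≤U , Q⇒R Qs′

    halts-seq : ∀ {r} {R : Store → Set r} {p p′ s T U} → Halts p s T Q →
                (∀ {s′} → Q s′ → Halts p′ s′ U R) → Halts (p ⨾ p′) s (T ℕ.+ U) R
    halts-seq (s′ , t , run , t≤T , Qs′) next with next Qs′
    ... | s″ , u , run′ , u≤U , Rs″ = s″ , t ℕ.+ u , seq run run′ , ℕ.+-mono-≤ t≤T u≤U , Rs″

    halts-assign : ∀ {k i s} → Q (setRegister k (⟦ i ⟧ⁱ s) s) → Halts (k ≔ i) s 1 Q
    halts-assign Qs = _ , _ , assign , ℕ.≤-refl , Qs

    halts-assignCell : ∀ {a i j e s} → Q (setCell a (⟦ i ⟧ⁱ s) (⟦ j ⟧ⁱ s) (⟦ e ⟧ s) s) →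
                       Halts (a [ i , j ]≔ e) s (suc (exprCost e)) Q
    halts-assignCell Qs = _ , _ , assignCell , ℕ.≤-refl , Qs

    halts-skip : ∀ {s} → Q s → Halts skip s 0 Q
    halts-skip Qs = _ , _ , skip , ℕ.≤-refl , Qs

    halts-cond-true : ∀ {b p p′ s T} → ⟦ b ⟧ᵗ s ≡ true → Halts p s T Q →
                      Halts (cond b p p′) s (testCost b ℕ.+ T) Q
    halts-cond-true {b} b≡ (s′ , t , run , t≤T , Qs′) =
      s′ , _ , cond-true b≡ run , ℕ.+-monoʳ-≤ (testCost b) t≤T , Qs′

    halts-cond-false : ∀ {b p p′ s T} → ⟦ b ⟧ᵗ s ≡ false → Halts p′ s T Q →
                       Halts (cond b p p′) s (testCost b ℕ.+ T) Q
    halts-cond-false {b} b≡ (s′ , t , run , t≤T , Qs′) =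
      s′ , _ , cond-false b≡ run , ℕ.+-monoʳ-≤ (testCost b) t≤T , Qs′

    -- The types of the oracle's arguments depend on the value of register 0. Identifying that value
    -- with `n` once spares later phases every transport along the equation.
    halts-query : ∀ {n r c B ε X s} → register s 0 ≡ n →
      let rˢ = readVector s r n
          cˢ = readVector s c n
          Bˢ = readMatrix s B n n
          εˢ = array s ε 0 0
      in Q (writeMatrix X (Oracle.answer 𝒪 rˢ cˢ Bˢ εˢ) s) →
         Halts (query (reg 0) (reg 0) r c B ε X) s (suc (Oracle.time 𝒪 rˢ cˢ Bˢ εˢ)) Q
    halts-query ≡.refl Qs = _ , _ , query , ℕ.≤-refl , Qs

  register-setRegister : ∀ k v s → register (setRegister k v s) k ≡ v
  register-setRegister k v s =
    ≡.cong (if_then v else register s k) (dec-true (k ℕ.≟ k) ≡.refl)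

  module _ {n} .{{_ : NonZero n}} (k : ℕ) {p : Program} {q} (I : ℕ → Store → Set q)
           (I-setRegister : ∀ {i s} v → I i s → I i (setRegister (suc k) v s))
           {T : ℕ}
           (step : ∀ (i : Fin n) {s} → register s 0 ≡ n → register s (suc k) ≡ toℕ i →
                   I (toℕ i) s → Halts p s T λ s′ → register s′ 0 ≡ n ×
                     register s′ (suc k) ≡ toℕ i × I (suc (toℕ i)) s′) where

    private
      Post : Store → Set q
      Post s = register s 0 ≡ n × I n s

      -- Induction on the number `d` of rounds left; `i + d ≡ n` supplies the bound that turns the
      -- counter into a `Fin n`.
      iterate : ∀ d i {s} → i ℕ.+ d ≡ n → register s 0 ≡ n → register s (suc k) ≡ i → I i s →
                Halts (while (reg (suc k) <ⁱ reg 0) (p ⨾ inc (suc k))) s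
                      (d ℕ.* (2 ℕ.+ T) ℕ.+ 1) Post
      iterate 0 i {s} i+0≡n n≡ i≡ Is =
        _ , _ , while-false (dec-false (_ ℕ.<? _) (ℕ.<-irrefl stop)) , ℕ.≤-refl ,
        n≡ , ≡.subst (λ i → I i s) i≡n Is
        where
        i≡n  = ≡.trans (≡.sym (ℕ.+-identityʳ i)) i+0≡n
        stop = ≡.trans i≡ (≡.trans i≡n (≡.sym n≡))
      iterate (suc d) i {s} i+1+d≡n n≡ i≡ Is =
        let i<n = ≡.subst (i ℕ.<_) i+1+d≡n (ℕ.m<m+n i (ℕ.s≤s ℕ.z≤n))
            j   = fromℕ< i<n
            j≡i = toℕ-fromℕ< i<n
            s₁ , t₁ , run₁ , t₁≤T , n≡₁ , i≡₁ , Is₁ =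
              step j n≡ (≡.trans i≡ (≡.sym j≡i)) (≡.subst (λ i → I i s) (≡.sym j≡i) Is)
            i≡₂ = ≡.trans (register-setRegister (suc k) _ s₁)
                          (≡.cong suc (≡.trans i≡₁ j≡i))
            Is₂ = I-setRegister _ (≡.subst (λ i → I (suc i) s₁) j≡i Is₁)
            s₂ , t₂ , run₂ , t₂≤ , post =
              iterate d (suc i) (≡.trans (≡.sym (ℕ.+-suc i d)) i+1+d≡n) n≡₁ i≡₂ Is₂
            continue = ≡.subst₂ ℕ._<_ (≡.sym i≡) (≡.sym n≡) i<n
        in s₂ , _ , while-true (dec-true (_ ℕ.<? _) continue) (seq run₁ inc) run₂ ,
           (begin
             1 ℕ.+ (t₁ ℕ.+ 1 ℕ.+ t₂)  ≤⟨ ℕ.s≤s (ℕ.+-mono-≤ (ℕ.+-monoˡ-≤ 1 t₁≤T) t₂≤) ⟩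
             1 ℕ.+ (T ℕ.+ 1 ℕ.+ (d ℕ.* (2 ℕ.+ T) ℕ.+ 1))
               ≡⟨ solve 2 (λ T x → con 1 :+ (T :+ con 1 :+ (x :+ con 1))
                    := con 2 :+ T :+ x :+ con 1) ≡.refl T (d ℕ.* (2 ℕ.+ T)) ⟩
             suc d ℕ.* (2 ℕ.+ T) ℕ.+ 1  ∎) ,
           post
        where
        open ℕ.≤-Reasoning
        open +-*-Solver

    -- Each round adds a test and an increment to `T`. The initial assignment and the last test cost
    -- 2 more, which is at most 2 n. The counter is `suc k`, hence never register 0, which holds the
    -- loop bound.
    halts-for : ∀ {s} → register s 0 ≡ n → I 0 s →
                Halts (for (suc k) p) s (n ℕ.* (4 ℕ.+ T)) Post
    halts-for {s} n≡ Is = halts-weaken bound (λ post → post)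
      (halts-seq {Q = λ s → register s 0 ≡ n × register s (suc k) ≡ 0 × I 0 s}
        (halts-assign (n≡ , register-setRegister (suc k) 0 s , I-setRegister 0 Is))
        λ (n≡ , 0≡ , Is) → iterate n 0 ≡.refl n≡ 0≡ Is)
      where
      open ℕ.≤-Reasoning
      bound : 1 ℕ.+ (n ℕ.* (2 ℕ.+ T) ℕ.+ 1) ℕ.≤ n ℕ.* (4 ℕ.+ T)
      bound = begin
        1 ℕ.+ (n ℕ.* (2 ℕ.+ T) ℕ.+ 1)  ≡⟨ ≡.cong suc (ℕ.+-comm _ 1) ⟩
        2 ℕ.+ n ℕ.* (2 ℕ.+ T)          ≤⟨ ℕ.+-monoˡ-≤ _ (ℕ.m≤n*m 2 n) ⟩
        n ℕ.* 2 ℕ.+ n ℕ.* (2 ℕ.+ T)    ≡⟨ ℕ.*-distribˡ-+ n 2 (2 ℕ.+ T) ⟨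
        n ℕ.* (4 ℕ.+ T)                ∎

  -- As `J` sees only the memory, updates of the counters preserve it for free. The 8 is the
  -- overhead of 4 from each of the two loops.
  halts-for² : ∀ {n} .{{_ : NonZero n}} {p q} (J : ℕ → ℕ → Memory → Set q) →
               (∀ i m → J i n m → J (suc i) 0 m) → ∀ {T} →
               (∀ (i j : Fin n) {s} → register s 1 ≡ toℕ i → register s 2 ≡ toℕ j →
                J (toℕ i) (toℕ j) (array s) → Halts p s T λ s′ →
                  register s′ ≡ register s × J (toℕ i) (suc (toℕ j)) (array s′)) →
               ∀ {s} → register s 0 ≡ n → J 0 0 (array s) →
               Halts (for 1 (for 2 p)) s ((8 ℕ.+ T) ℕ.* n ^ 2)
                 λ s′ → register s′ 0 ≡ n × J n 0 (array s′)
  halts-for² {n} J next-row {T} step n≡ J₀ =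
    halts-weaken (n*[a+n*b]≤[a+b]*n² 4 (4 ℕ.+ T) n) (λ post → post)
      (halts-for 0 (λ i s → J i 0 (array s)) (λ _ Js → Js)
        (λ i n≡ i≡ Js → halts-weaken ℕ.≤-refl (λ (n≡ , i≡ , Js) → n≡ , i≡ , next-row _ _ Js)
          (halts-for 1 (λ j s → register s 1 ≡ toℕ i × J (toℕ i) j (array s)) (λ _ Js → Js)
            (λ j n≡ j≡ (i≡ , Js) → halts-weaken ℕ.≤-refl
              (λ (same , Js) → ≡.trans (≡.cong-app same 0) n≡ , ≡.trans (≡.cong-app same 2) j≡
                             , ≡.trans (≡.cong-app same 1) i≡ , Js)
              (step i j i≡ j≡ Js))
            n≡ (i≡ , Js)))
        n≡ J₀)

  module _ (a : Array) (i j : ℕ) (x : Carrier) (s : Store) where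

    setCell-at : array (setCell a i j x s) a i j ≡ x
    setCell-at rewrite dec-true (a ℕ.≟ a) ≡.refl | dec-true (i ℕ.≟ i) ≡.refl
                     | dec-true (j ℕ.≟ j) ≡.refl = ≡.refl

    setCell-other : ∀ {i′ j′} → ¬ (i′ ≡ i × j′ ≡ j) →
                    array (setCell a i j x s) a i′ j′ ≡ array s a i′ j′
    setCell-other {i′} {j′} ≢ rewrite dec-true (a ℕ.≟ a) ≡.refl with i′ ℕ.≟ i
    ... | no i′≢i rewrite dec-false (i′ ℕ.≟ i) i′≢i = ≡.refl
    ... | yes ≡.refl rewrite dec-true (i ℕ.≟ i) ≡.refl
                           | dec-false (j′ ℕ.≟ j) (≢ ∘ (≡.refl ,_)) = ≡.refl

  module _ {n} .{{_ : NonZero n}} (a : Array) (e : Expr) {q q′} (P : Memory → Set q)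
           (P-setCell : ∀ {s} i j x → P (array s) → P (array (setCell a i j x s)))
           (G : Fin n → Fin n → Carrier → Set q′)
           (value : ∀ i j {s} → register s 1 ≡ toℕ i → register s 2 ≡ toℕ j →
                    P (array s) → G i j (⟦ e ⟧ s)) where

    private
      J : ℕ → ℕ → Memory → Set (q ⊔ q′)
      J i j m = P m × ∀ i′ j′ → Before i j (toℕ i′) (toℕ j′) → G i′ j′ (m a (toℕ i′) (toℕ j′))

      step : ∀ (i j : Fin n) {s} → register s 1 ≡ toℕ i → register s 2 ≡ toℕ j →
             J (toℕ i) (toℕ j) (array s) →
             J (toℕ i) (suc (toℕ j)) (array (setCell a (register s 1) (register s 2) (⟦ e ⟧ s) s))
      step i j {s} i≡ j≡ (Ps , done) rewrite i≡ | j≡ = P-setCell {s} _ _ _ Ps , done′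
        where
        done′ : ∀ i′ j′ → Before (toℕ i) (suc (toℕ j)) (toℕ i′) (toℕ j′) →
                G i′ j′ (array (setCell a (toℕ i) (toℕ j) (⟦ e ⟧ s) s) a (toℕ i′) (toℕ j′))
        done′ i′ j′ before with toℕ i′ ℕ.≟ toℕ i ×-dec toℕ j′ ℕ.≟ toℕ j
        ... | no ≢ = ≡.subst (G i′ j′) (≡.sym (setCell-other a _ _ _ s ≢))
                       (done i′ j′ (before-sucʳ before ≢))
        ... | yes (i′≡i , j′≡j) with toℕ-injective i′≡i | toℕ-injective j′≡j
        ... | ≡.refl | ≡.refl = ≡.subst (G i j) (≡.sym (setCell-at a _ _ _ s)) (value i j i≡ j≡ Ps)

    -- `P` carries the facts on which `e` relies and must survive writes to `a`; `G` is the
    -- specification of each entry. The 9 is the loop overhead of 8 and one step for the store.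
    halts-fill : ∀ {s} → register s 0 ≡ n → P (array s) →
                 Halts (fill a e) s ((9 ℕ.+ exprCost e) ℕ.* n ^ 2)
                   λ s′ → register s′ 0 ≡ n × P (array s′) ×
                          ∀ i j → G i j (readMatrix s′ a n n i j)
    halts-fill n≡ Ps = halts-weaken cost
      (λ (n≡ , Ps , done) → n≡ , Ps , λ i j → done i j (inj₁ (toℕ<n i)))
      (halts-for² J (λ _ _ (Ps , done) → Ps , λ i j → done i j ∘ before-sucˡ (toℕ<n j))
        (λ i j i≡ j≡ Js → halts-assignCell (≡.refl , step i j i≡ j≡ Js))
        n≡ (Ps , λ _ _ before → contradiction before not-before))
      where
      cost : (8 ℕ.+ suc (exprCost e)) ℕ.* n ^ 2 ℕ.≤ (9 ℕ.+ exprCost e) ℕ.* n ^ 2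
      cost = ℕ.≤-reflexive (≡.cong (ℕ._* n ^ 2) (ℕ.+-suc 8 (exprCost e)))

  readMatrix-writeMatrix : ∀ {m l} a (X : Matrix m l) s i j →
                           readMatrix (writeMatrix a X s) a m l i j ≡ X i j
  readMatrix-writeMatrix {m} {l} a X s i j
    rewrite dec-true (a ℕ.≟ a) ≡.refl with toℕ i ℕ.<? m | toℕ j ℕ.<? l
  ... | yes i<m | yes j<l = ≡.cong₂ X (fromℕ<-toℕ i i<m) (fromℕ<-toℕ j j<l)
  ... | no i≮m  | _       = contradiction (toℕ<n i) i≮m
  ... | yes _   | no j≮l  = contradiction (toℕ<n j) j≮l

-- The transport program.

-- Moduli are not computed: for a non-negative matrix, a running maximum that starts at 0 already
-- ends at the norm.
maximum : Program
maximum = 6 [ lit 0 , lit 0 ]≔ zero ⨾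
          for 1 (for 2 (cond ((2 [ reg 1 , reg 2 ]) ≤ʳ (6 [ lit 0 , lit 0 ])) skip
                             (6 [ lit 0 , lit 0 ]≔ (2 [ reg 1 , reg 2 ]))))

-- When the query is skipped, array 11 serves as the packing. This is why `transport` clears it
-- beforehand, memory being arbitrary at the start.
pack : Program
pack = cond ((6 [ lit 0 , lit 0 ]) ≤ʳ zero) skip
            (7 [ lit 0 , lit 0 ]≔ ((3 [ lit 0 , lit 0 ]) ⊘ (6 [ lit 0 , lit 0 ])) ⨾
             query (reg 0) (reg 0) 0 1 5 7 11)

-- The matrix is square, so one pass of register 1 handles row i and column i together, reading the
-- packing at (i, j) and (j, i). Only row demands are totalled, because the column demands have the
-- same sum.
demand : Program
demand =
  10 [ lit 0 , lit 0 ]≔ zero ⨾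
  for 1 (8 [ reg 1 , lit 0 ]≔ (0 [ reg 1 , lit 0 ]) ⨾
         9 [ reg 1 , lit 0 ]≔ (1 [ reg 1 , lit 0 ]) ⨾
         for 2 (8 [ reg 1 , lit 0 ]≔ ((8 [ reg 1 , lit 0 ]) ⊖ (11 [ reg 1 , reg 2 ])) ⨾
                9 [ reg 1 , lit 0 ]≔ ((9 [ reg 1 , lit 0 ]) ⊖ (11 [ reg 2 , reg 1 ]))) ⨾
         10 [ lit 0 , lit 0 ]≔ ((10 [ lit 0 , lit 0 ]) ⊕ (8 [ reg 1 , lit 0 ])))

roundedEntry : Expr
roundedEntry = (11 [ reg 1 , reg 2 ]) ⊕
  (((8 [ reg 1 , lit 0 ]) ⊗ (9 [ reg 2 , lit 0 ])) ⊘ (10 [ lit 0 , lit 0 ]))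

-- Arrays 5 to 11 hold B, ‖ C ‖max, the oracle's accuracy ε / ‖ C ‖max, the unmet
-- demands of the rows and of the columns, their total, and the packing.
transport : Program
transport =
  fill 11 zero ⨾
  maximum ⨾
  fill 5 ((6 [ lit 0 , lit 0 ]) ⊖ (2 [ reg 1 , reg 2 ])) ⨾
  pack ⨾
  demand ⨾
  fill 4 roundedEntry

-- Correctness of the phases of the program.

module Transport {ℓ ℓ₁ ℓ₂} (ℝ : Reals ℓ ℓ₁ ℓ₂) (𝒪 : OptimalTransport.Oracle ℝ) where

  open OptimalTransport ℝ hiding (zero)
  open OrderedField ℝ
  open Rounding ℝ
  open Execution ℝ 𝒪

  sumTo : ℕ → (ℕ → Carrier) → Carrier
  sumTo n f = sum {n} (f ∘ toℕ)

  -- `sum` unfolds at the front, whereas a loop adds its newest term at the end.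
  sumTo-suc : ∀ n f → sumTo (suc n) f ≈ sumTo n f + f n
  sumTo-suc zero    f = +-comm _ _
  sumTo-suc (suc n) f = trans (+-congˡ (sumTo-suc n (f ∘ suc))) (sym (+-assoc _ _ _))

  module _ {n} .{{_ : NonZero n}} {r c : Vector Carrier n} {C : Matrix n n} {ε : Carrier}
           (input : TransportInput r c C ε) where

    open TransportInput input

    -- A function rather than a record, so that writing to other arrays preserves
    -- it definitionally.
    Input : Memory → Set ℓ₁
    Input m = (∀ i → m 0 (toℕ i) 0 ≈ r i) × (∀ j → m 1 (toℕ j) 0 ≈ c j) ×
              (∀ i j → m 2 (toℕ i) (toℕ j) ≈ C i j) × m 3 0 0 ≈ ε

    Cleared : Memory → Set ℓ₁
    Cleared m = Input m × (∀ (i j : Fin n) → m 11 (toℕ i) (toℕ j) ≈ 0#)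

    Measured : Memory → Set ℓ₁
    Measured m = Cleared m × m 6 0 0 ≈ ‖ C ‖max

    Complemented : Memory → Set ℓ₁
    Complemented m = Measured m × (∀ i j → m 5 (toℕ i) (toℕ j) ≈ ‖ C ‖max - C i j)

    Packed : Memory → Set (ℓ ⊔ ℓ₁ ⊔ ℓ₂)
    Packed m = Input m × Roundable r c C ε (λ i j → m 11 (toℕ i) (toℕ j))

    halts-clear : ∀ {s} → register s 0 ≡ n → Input (array s) →
                  Halts (fill 11 zero) s (10 ℕ.* n ^ 2)
                    λ s′ → register s′ 0 ≡ n × Cleared (array s′)
    halts-clear = halts-fill 11 zero Input (λ _ _ _ Is → Is) (λ _ _ x → x ≈ 0#)
                    (λ _ _ _ _ _ → refl)

    halts-maximum : ∀ {s} → register s 0 ≡ n → Cleared (array s) →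
                    Halts maximum s (15 ℕ.* n ^ 2)
                      λ s′ → register s′ 0 ≡ n × Measured (array s′)
    halts-maximum n≡ cleared = halts-weaken cost (λ {s} → finish s)
      (halts-seq {Q = λ s → register s 0 ≡ n × J 0 0 (array s)}
        (halts-assignCell (n≡ , cleared , ≤-refl , ‖‖max-nonNeg C ,
           λ _ _ before → contradiction before not-before))
        λ (n≡ , J₀) → halts-for² J next-row step n≡ J₀)
      where
      -- The running maximum stays between the visited entries and the norm. Once all entries are
      -- visited, the two bounds force equality.
      J : ℕ → ℕ → Memory → Set (ℓ₁ ⊔ ℓ₂)
      J i j m = Cleared m × 0# ≤ m 6 0 0 × m 6 0 0 ≤ ‖ C ‖max ×
                (∀ i′ j′ → Before i j (toℕ i′) (toℕ j′) → C i′ j′ ≤ m 6 0 0)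

      next-row : ∀ i m → J i n m → J (suc i) 0 m
      next-row _ _ (cleared , 0≤M , M≤‖C‖ , C≤M) =
        cleared , 0≤M , M≤‖C‖ , λ i j → C≤M i j ∘ before-sucˡ (toℕ<n j)

      extend : ∀ {i j : Fin n} {u} → C i j ≤ u →
               (∀ i′ j′ → Before (toℕ i) (toℕ j) (toℕ i′) (toℕ j′) → C i′ j′ ≤ u) →
               ∀ i′ j′ → Before (toℕ i) (suc (toℕ j)) (toℕ i′) (toℕ j′) → C i′ j′ ≤ u
      extend {i} {j} Cij≤u C≤u i′ j′ before
        with toℕ i′ ℕ.≟ toℕ i ×-dec toℕ j′ ℕ.≟ toℕ j
      ... | no ≢ = C≤u i′ j′ (before-sucʳ before ≢)
      ... | yes (i′≡i , j′≡j) with toℕ-injective i′≡i | toℕ-injective j′≡j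
      ... | ≡.refl | ≡.refl = Cij≤u

      step : ∀ (i j : Fin n) {s} → register s 1 ≡ toℕ i → register s 2 ≡ toℕ j →
             J (toℕ i) (toℕ j) (array s) →
             Halts (cond ((2 [ reg 1 , reg 2 ]) ≤ʳ (6 [ lit 0 , lit 0 ])) skip
                         (6 [ lit 0 , lit 0 ]≔ (2 [ reg 1 , reg 2 ]))) s 5
               λ s′ → register s′ ≡ register s × J (toℕ i) (suc (toℕ j)) (array s′)
      step i j {s} i≡ j≡ (cleared@((_ , _ , C≈ , _) , _) , 0≤M , M≤‖C‖ , C≤M)
        with array s 2 (register s 1) (register s 2) ≤? array s 6 0 0
           | trans (reflexive (≡.cong₂ (array s 2) i≡ j≡)) (C≈ i j)
      ... | yes x≤M | x≈C = halts-weaken (ℕ.m≤m+n 3 2) (λ post → post) (halts-cond-true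
        (dec-true (_ ≤? _) x≤M)
        (halts-skip (≡.refl , cleared , 0≤M , M≤‖C‖ , extend (≤-respˡ-≈ x≈C x≤M) C≤M)))
      ... | no x≰M | x≈C = halts-cond-false (dec-false (_ ≤? _) x≰M)
        (halts-assignCell
          (≡.refl , cleared , ≤-trans 0≤M M≤x , ≤-respˡ-≈ (sym x≈C) (entry≤‖‖max C i j) ,
           extend (≤-reflexive (sym x≈C)) (λ i′ j′ b → ≤-trans (C≤M i′ j′ b) M≤x)))
        where
        M≤x = ≰⇒≥ x≰M

      cost : 2 ℕ.+ 13 ℕ.* n ^ 2 ℕ.≤ 15 ℕ.* n ^ 2
      cost = a+b*n²≤[a+b]*n² 2 13 n

      finish : ∀ s → register s 0 ≡ n × J n 0 (array s) →
               register s 0 ≡ n × Measured (array s)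
      finish _ (n≡ , cleared , 0≤M , M≤‖C‖ , C≤M) =
        n≡ , cleared ,
        antisym M≤‖C‖ (‖‖max-lub C C≥0 0≤M λ i j → C≤M i j (inj₁ (toℕ<n i)))

    halts-complement : ∀ {s} → register s 0 ≡ n → Measured (array s) →
                       Halts (fill 5 ((6 [ lit 0 , lit 0 ]) ⊖ (2 [ reg 1 , reg 2 ]))) s (12 ℕ.* n ^ 2)
                         λ s′ → register s′ 0 ≡ n × Complemented (array s′)
    halts-complement = halts-fill 5 _ Measured (λ _ _ _ Ms → Ms)
      (λ i j x → x ≈ ‖ C ‖max - C i j)
      λ i j {s} i≡ j≡ (((_ , _ , C≈ , _) , _) , M≈) →
        +-cong M≈ (-‿cong (trans (reflexive (≡.cong₂ (array s 2) i≡ j≡)) (C≈ i j)))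

    module _ (m₀ : Memory) where

      rowDemand colDemand : ℕ → Carrier
      rowDemand i = m₀ 0 i 0 - sumTo n (m₀ 11 i)
      colDemand j = m₀ 1 j 0 - sumTo n (λ i → m₀ 11 i j)

      -- `m₀` is a snapshot of the memory at the start of the phase. Equating whole arrays makes
      -- this survive writes to arrays 8, 9 and 10 definitionally.
      Fixed : Memory → Set ℓ
      Fixed m = m 0 ≡ m₀ 0 × m 1 ≡ m₀ 1 × m 11 ≡ m₀ 11

      Demanded : ℕ → Memory → Set (ℓ ⊔ ℓ₁)
      Demanded i m = Fixed m × (∀ k → k ℕ.< i → m 8 k 0 ≈ rowDemand k × m 9 k 0 ≈ colDemand k) ×
                     m 10 0 0 ≈ sumTo i rowDemand

      private
        -- The state inside round i: the demands below i are final, while those at i have the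
        -- intermediate values `x` and `y`.
        Partial : ℕ → Carrier → Carrier → Memory → Set (ℓ ⊔ ℓ₁)
        Partial i x y m = Demanded i m × m 8 i 0 ≈ x × m 9 i 0 ≈ y

        set-row : ∀ {i i′ x x′ y v} s → i′ ≡ i → v ≈ x′ → Partial i x y (array s) →
                  Partial i x′ y (array (setCell 8 i′ 0 v s))
        set-row {i} {v = v} s ≡.refl v≈x′ ((fixed , done , total) , _ , y≈) =
          (fixed ,
           (λ k k<i → trans (reflexive (setCell-other 8 i 0 v s (ℕ.<⇒≢ k<i ∘ proj₁)))
                            (proj₁ (done k k<i)) , proj₂ (done k k<i)) ,
           total) , trans (reflexive (setCell-at 8 i 0 v s)) v≈x′ , y≈

        set-col : ∀ {i i′ x y y′ v} s → i′ ≡ i → v ≈ y′ → Partial i x y (array s) →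
                  Partial i x y′ (array (setCell 9 i′ 0 v s))
        set-col {i} {v = v} s ≡.refl v≈y′ ((fixed , done , total) , x≈ , _) =
          (fixed ,
           (λ k k<i → proj₁ (done k k<i) ,
                      trans (reflexive (setCell-other 9 i 0 v s (ℕ.<⇒≢ k<i ∘ proj₁)))
                            (proj₂ (done k k<i))) ,
           total) , x≈ , trans (reflexive (setCell-at 9 i 0 v s)) v≈y′

        cell : ∀ {s a i j i′ j′} → array s a ≡ m₀ a → i ≡ i′ → j ≡ j′ →
               array s a i j ≈ m₀ a i′ j′
        cell {s} {a} {i} {j} a≡ ≡.refl ≡.refl = reflexive (≡.cong (λ f → f i j) a≡)

        subtract : ∀ {x y z} k f → y ≈ x - sumTo k f → z ≈ f k → y - z ≈ x - sumTo (suc k) f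
        subtract {x} {y} {z} k f y≈ z≈ = begin-equality
          y - z                  ≈⟨ +-cong y≈ (-‿cong z≈) ⟩
          x - sumTo k f - f k    ≈⟨ +-assoc x _ _ ⟩
          x + (- sumTo k f - f k) ≈⟨ +-congˡ (-‿+-comm (sumTo k f) (f k)) ⟩
          x - (sumTo k f + f k)  ≈⟨ +-congˡ (-‿cong (sumTo-suc k f)) ⟨
          x - sumTo (suc k) f    ∎
          where open PosetReasoning poset

        Inner : ℕ → ℕ → Store → Set (ℓ ⊔ ℓ₁)
        Inner i j s = register s 1 ≡ i ×
          Partial i (m₀ 0 i 0 - sumTo j (m₀ 11 i)) (m₀ 1 i 0 - sumTo j (λ k → m₀ 11 k i)) (array s)

        -- Presents a freshly copied marginal as that marginal minus an empty sum, the form of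
        -- `Inner` at j = 0.
        x≈y⇒x≈y-0 : ∀ {x y} → x ≈ y → x ≈ y - 0#
        x≈y⇒x≈y-0 {y = y} x≈y = trans x≈y (sym (trans (+-congˡ -0≈0) (+-identityʳ y)))

        finish-row : ∀ {i} s → register s 1 ≡ i → Partial i (rowDemand i) (colDemand i) (array s) →
                     Demanded (suc i)
                       (array (setCell 10 0 0 (array s 10 0 0 + array s 8 (register s 1) 0) s))
        finish-row {i} _ ≡.refl ((fixed , done , total) , x≈ , y≈) =
          fixed , done′ , trans (+-cong total x≈) (sym (sumTo-suc i rowDemand))
          where
          done′ : ∀ k → k ℕ.< suc i → _
          done′ k k<1+i with ℕ.m≤n⇒m<n∨m≡n (ℕ.s≤s⁻¹ k<1+i)
          ... | inj₁ k<i    = done k k<i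
          ... | inj₂ ≡.refl = x≈ , y≈

      halts-demand : ∀ {s} → register s 0 ≡ n → array s ≡ m₀ →
                     Halts demand s (26 ℕ.* n ^ 2)
                       λ s′ → register s′ 0 ≡ n × Demanded n (array s′)
      halts-demand n≡ ≡.refl = halts-weaken cost (λ post → post)
        (halts-seq {Q = λ s → register s 0 ≡ n × Demanded 0 (array s)}
          (halts-assignCell (n≡ , (≡.refl , ≡.refl , ≡.refl) , (λ _ ()) , refl))
          λ (n≡ , D₀) → halts-for 0 (λ i s → Demanded i (array s)) (λ _ Ds → Ds)
            (λ i {s} n≡ i≡ Ds →
              halts-seq {Q = λ s′ → register s′ 0 ≡ n × register s′ 1 ≡ toℕ i ×
                               -- Array 9 is not yet initialised at i, so its present content,
                               -- whatever it is, stands for the column demand.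
                               Partial (toℕ i) (m₀ 0 (toℕ i) 0 - 0#) (array s 9 (toℕ i) 0) (array s′)}
                (halts-assignCell (n≡ , i≡ ,
                  set-row s i≡ (x≈y⇒x≈y-0 (cell {s} (proj₁ (proj₁ Ds)) i≡ ≡.refl)) (Ds , refl , refl)))
              λ {s₁} (n≡ , i≡ , D₁) →
              halts-seq {Q = λ s′ → register s′ 0 ≡ n × Inner (toℕ i) 0 s′}
                (halts-assignCell (n≡ , i≡ ,
                  set-col s₁ i≡ (x≈y⇒x≈y-0 (cell {s₁} (proj₁ (proj₂ (proj₁ (proj₁ D₁)))) i≡ ≡.refl)) D₁))
              λ (n≡ , I₀) →
              halts-seq {Q = λ s′ → register s′ 0 ≡ n × Inner (toℕ i) n s′}
                (halts-for 1 (Inner (toℕ i)) (λ _ Is → Is)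
                  (λ j {s} n≡ j≡ (i≡ , D@((((_ , _ , X≡) , _) , x≈ , y≈))) →
                    halts-seq {Q = λ s′ → register s′ 0 ≡ n × register s′ 2 ≡ toℕ j ×
                                     register s′ 1 ≡ toℕ i × Partial (toℕ i)
                                       (m₀ 0 (toℕ i) 0 - sumTo (suc (toℕ j)) (m₀ 11 (toℕ i)))
                                       (m₀ 1 (toℕ i) 0 - sumTo (toℕ j) (λ k → m₀ 11 k (toℕ i)))
                                       (array s′)}
                      (halts-assignCell (n≡ , j≡ , i≡ ,
                        set-row s i≡ (subtract (toℕ j) (m₀ 11 (toℕ i))
                          (trans (reflexive (≡.cong (λ k → array s 8 k 0) i≡)) x≈)
                          (cell {s} X≡ i≡ j≡)) D))
                    λ {s₁} (n≡ , j≡ , i≡ , D@((((_ , _ , X≡) , _) , x≈ , y≈))) →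
                    halts-assignCell (n≡ , j≡ , i≡ ,
                      set-col s₁ i≡ (subtract (toℕ j) (λ k → m₀ 11 k (toℕ i))
                        (trans (reflexive (≡.cong (λ k → array s₁ 9 k 0) i≡)) y≈)
                        (cell {s₁} X≡ j≡ i≡)) D))
                  n≡ I₀)
              λ {s₂} (n≡ , i≡ , D₂) → halts-assignCell (n≡ , i≡ , finish-row s₂ i≡ D₂))
            n≡ D₀)
        where
        cost : 2 ℕ.+ n ℕ.* (4 ℕ.+ (2 ℕ.+ (2 ℕ.+ (n ℕ.* 12 ℕ.+ 4)))) ℕ.≤ 26 ℕ.* n ^ 2
        cost = begin
          2 ℕ.+ n ℕ.* (8 ℕ.+ (n ℕ.* 12 ℕ.+ 4))  ≡⟨ ≡.cong (λ x → 2 ℕ.+ n ℕ.* (8 ℕ.+ x)) (ℕ.+-comm (n ℕ.* 12) 4) ⟩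
          2 ℕ.+ n ℕ.* (12 ℕ.+ n ℕ.* 12)         ≤⟨ ℕ.+-monoʳ-≤ 2 (n*[a+n*b]≤[a+b]*n² 12 12 n) ⟩
          2 ℕ.+ 24 ℕ.* n ^ 2                    ≤⟨ a+b*n²≤[a+b]*n² 2 24 n ⟩
          26 ℕ.* n ^ 2                          ∎
          where open ℕ.≤-Reasoning

      halts-round : ∀ {s} → Packed m₀ → register s 0 ≡ n × Demanded n (array s) →
                    Halts (fill 4 roundedEntry) s (16 ℕ.* n ^ 2)
                      λ s′ → ApproxTransport r c C ε (output s′ n)
      halts-round {s} ((r≈ , c≈ , _) , roundable)
                  (n≡ , (_ , _ , X≡) , demands , total) =
        halts-weaken ℕ.≤-refl
          (λ {s′} (_ , _ , X̂≈) →
            -- The divisor passed on is the memory cell itself, the one whose inverse `roundedEntry`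
            -- takes.
            optimal (rounded∈𝒰 Σr≈Σc packs a b (array s 10 0 0) a≈ b≈ s≈ (output s′ n) X̂≈)
                    (X≤rounded Σr≈Σc packs a b (array s 10 0 0) a≈ b≈ s≈ (output s′ n) X̂≈))
          (halts-fill 4 roundedEntry P (λ _ _ _ Ps → Ps) G value n≡ (X≡ , ≡.refl , ≡.refl , ≡.refl))
        where
        open Roundable roundable

        a b : Vector Carrier n
        a i = array s 8 (toℕ i) 0
        b j = array s 9 (toℕ j) 0

        Σr≈Σc : sum r ≈ sum c
        Σr≈Σc = trans (proj₂ r∈Δ) (sym (proj₂ c∈Δ))

        a≈rowDemand : ∀ i → a i ≈ rowDemand (toℕ i)
        a≈rowDemand i = proj₁ (demands (toℕ i) (toℕ<n i))

        a≈ : ∀ i → a i ≈ r i - sumTo n (m₀ 11 (toℕ i))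
        a≈ i = trans (a≈rowDemand i) (+-congʳ (r≈ i))

        b≈ : ∀ j → b j ≈ c j - sumTo n (λ i → m₀ 11 i (toℕ j))
        b≈ j = trans (proj₂ (demands (toℕ j) (toℕ<n j))) (+-congʳ (c≈ j))

        s≈ : array s 10 0 0 ≈ sum a
        s≈ = trans total (sum-cong-≋ (sym ∘ a≈rowDemand))

        P : Memory → Set ℓ
        P m = m 11 ≡ m₀ 11 × m 8 ≡ array s 8 × m 9 ≡ array s 9 × m 10 ≡ array s 10

        G : Fin n → Fin n → Carrier → Set ℓ₁
        G i j x = x ≈ m₀ 11 (toℕ i) (toℕ j) + a i * b j / array s 10 0 0

        value : ∀ i j {s′} → register s′ 1 ≡ toℕ i → register s′ 2 ≡ toℕ j → P (array s′) →
                G i j (⟦ roundedEntry ⟧ s′)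
        value i j i≡ j≡ (X≡ , a≡ , b≡ , s≡) rewrite i≡ | j≡ | X≡ | a≡ | b≡ | s≡ = refl

    -- The oracle call and the total running time.

    module _ (𝒯 : ℕ → ℕ → Carrier → Carrier) (𝒯-runningTime : IsRunningTime 𝒯)
             (solves : SolvesPacking 𝒪) (inTime : RunsInTime 𝒪 𝒯) where

      private
        -- The constant of the oracle's time bound may be negative.
        K N T : Carrier
        K = max (proj₁ inTime) 0#
        N = fromℕ (n ^ 2)
        T = 𝒯 n n (‖ C ‖max / ε)

        0≤T : 0# ≤ T
        0≤T = IsRunningTime.nonNeg 𝒯-runningTime n n (*-nonNeg (‖‖max-nonNeg C) (⁻¹-nonNeg ε>0))

        -- `fromℕ k`, `K`, `N` and `T` are all non-negative, so the cross terms of the product on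
        -- the right only help.
        steps⇒time : ∀ k {t t₀} → t ℕ.≤ k ℕ.* n ^ 2 ℕ.+ t₀ → fromℕ t₀ ≤ K * T →
                     fromℕ t ≤ (fromℕ k + K) * (N + T)
        steps⇒time k {t} {t₀} t≤ t₀≤ = begin
          fromℕ t                              ≤⟨ fromℕ-mono-≤ t≤ ⟩
          fromℕ (k ℕ.* n ^ 2 ℕ.+ t₀)           ≈⟨ fromℕ-homo-+ (k ℕ.* n ^ 2) t₀ ⟩
          fromℕ (k ℕ.* n ^ 2) + fromℕ t₀       ≈⟨ +-congʳ (fromℕ-homo-* k (n ^ 2)) ⟩
          fromℕ k * N + fromℕ t₀               ≤⟨ +-mono-≤ (*-monoʳ-≤-nonNeg (fromℕ-nonNeg k) (x≤x+y 0≤T)) t₀≤ ⟩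
          fromℕ k * (N + T) + K * T            ≤⟨ +-monoʳ-≤ _ (*-monoʳ-≤-nonNeg (x≤y⊔x _ 0#) T≤N+T) ⟩
          fromℕ k * (N + T) + K * (N + T)      ≈⟨ distribʳ (N + T) (fromℕ k) K ⟨
          (fromℕ k + K) * (N + T)              ∎
          where
          open PosetReasoning poset
          T≤N+T : T ≤ N + T
          T≤N+T = ≤-respʳ-≈ (+-comm T N) (x≤x+y (fromℕ-nonNeg (n ^ 2)))

      halts-pack : ∀ {s} → register s 0 ≡ n → Complemented (array s) →
                   ∃ λ t → fromℕ t ≤ K * T ×
                     Halts pack s (8 ℕ.* n ^ 2 ℕ.+ t)
                       λ s′ → register s′ 0 ≡ n × Packed (array s′)
      halts-pack {s} n≡ (((inputs@(r≈ , c≈ , C≈ , ε≈) , X≈0) , M≈) , B≈) with array s 6 0 0 ≤? 0#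
      ... | yes M≤0 =
        0 , *-nonNeg (x≤y⊔x _ 0#) 0≤T ,
        halts-weaken cost (λ post → post)
          (halts-cond-true (dec-true (_ ≤? _) M≤0)
            (halts-skip (n≡ , inputs , zero-roundable input (≤-respˡ-≈ M≈ M≤0) X≈0)))
        where
        cost : 3 ℕ.≤ 8 ℕ.* n ^ 2 ℕ.+ 0
        cost = ℕ.≤-trans (ℕ.m≤m+n 3 5) (ℕ.≤-trans (a≤a*n² 8 n) (ℕ.m≤m+n _ 0))
      ... | no M≰0 =
        t , time≤ ,
        halts-weaken cost (λ post → post)
          (halts-cond-false {T = 4 ℕ.+ suc t} (dec-false (_ ≤? _) M≰0)
            -- Keeping the exact store pins down the arguments of the query: the write to array 7
            -- leaves arrays 0, 1 and 5 unchanged definitionally.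
            (halts-seq {Q = _≡ s₁} (halts-assignCell ≡.refl)
              λ { ≡.refl → halts-query n≡ (n≡ , inputs , roundable) }))
        where
        ε′ : Carrier
        ε′ = array s 3 0 0 / array s 6 0 0

        s₁ : Store
        s₁ = setCell 7 0 0 ε′ s

        rˢ cˢ : Vector Carrier n
        rˢ = readVector s 0 n
        cˢ = readVector s 1 n

        Bˢ : Matrix n n
        Bˢ = readMatrix s 5 n n

        t : ℕ
        t = Oracle.time 𝒪 rˢ cˢ Bˢ ε′

        0<M : 0# < array s 6 0 0
        0<M = ≰⇒≥ M≰0 , λ 0≈M → M≰0 (≤-reflexive (sym 0≈M))

        0<m₃ : 0# < array s 3 0 0
        0<m₃ = 0<-respʳ-≈ (sym ε≈) ε>0

        packingInput : PackingInput rˢ cˢ C Bˢ ε′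
        packingInput = record
          { m≢0 = ℕ.≢-nonZero (ℕ.≢-nonZero⁻¹ n)
          ; l≢0 = ℕ.≢-nonZero (ℕ.≢-nonZero⁻¹ n)
          ; r≥0 = λ i → ≤-respʳ-≈ (sym (r≈ i)) (proj₁ r∈Δ i)
          ; c≥0 = λ j → ≤-respʳ-≈ (sym (c≈ j)) (proj₁ c∈Δ j)
          ; C≥0 = C≥0
          ; B≈  = B≈
          ; ε>0 = /-positive 0<m₃ 0<M
          }

        ε′‖C‖≤ε : ε′ * ‖ C ‖max ≤ ε
        ε′‖C‖≤ε = ≤-reflexive
          (trans (*-congˡ (sym M≈)) (trans (x/y*y≈x _ (0<x⇒x≉0 0<M)) ε≈))

        roundable : Roundable r c C ε
                      (readMatrix (writeMatrix 11 (Oracle.answer 𝒪 rˢ cˢ Bˢ ε′) s₁) 11 n n)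
        roundable = Roundable-cong
          (λ i j → reflexive (≡.sym (readMatrix-writeMatrix 11 _ s₁ i j)))
          (packing⇒roundable input B≈ (proj₁ (/-positive 0<m₃ 0<M)) ε′‖C‖≤ε
            (ApproxPacking-cong r≈ c≈ (solves rˢ cˢ C Bˢ ε′ packingInput)))

        -- The source of the third argument of `𝒯` in the final bound. Memory holds M and ε only up
        -- to `_≈_`, hence the appeal to congruence of `_⁻¹` away from zero.
        1/ε′≈ : 1# / ε′ ≈ ‖ C ‖max / ε
        1/ε′≈ = trans (1/[x/y]≈y/x 0<m₃ 0<M) (*-cong M≈ (⁻¹-cong (0<x⇒x≉0 0<m₃) ε≈))

        time≤ : fromℕ t ≤ K * T
        time≤ = begin
          fromℕ t                              ≤⟨ proj₂ inTime rˢ cˢ C Bˢ ε′ packingInput ⟩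
          proj₁ inTime * 𝒯 n n (1# / ε′)       ≈⟨ *-congˡ (IsRunningTime.cong 𝒯-runningTime n n 1/ε′≈) ⟩
          proj₁ inTime * 𝒯 n n (‖ C ‖max / ε)
            ≤⟨ *-monoˡ-≤-nonNeg 0≤T (x≤x⊔y _ _) ⟩
          K * T                                ∎
          where open PosetReasoning poset

        cost : 3 ℕ.+ (4 ℕ.+ suc t) ℕ.≤ 8 ℕ.* n ^ 2 ℕ.+ t
        -- The 8 consists of 3 for the test, 4 for dividing and storing, and 1 for issuing the
        -- query.
        cost = ℕ.+-monoˡ-≤ t (a≤a*n² 8 n)

      private
        -- The oracle's time `t` is a separate summand because its bound is a real number unrelated
        -- to n². Only one phase contributes to it.
        HaltsInTime : ∀ {q} → Program → Store → ℕ → (Store → Set q) → Set _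
        HaltsInTime p s k Q = ∃ λ t → fromℕ t ≤ K * T × Halts p s (k ℕ.* n ^ 2 ℕ.+ t) Q

        real-time : ∀ {q} {Q : Store → Set q} {p s} k → HaltsInTime p s k Q →
                    ∃ λ s′ → ∃ λ t → Run 𝒪 p s t s′ × Q s′ × fromℕ t ≤ (fromℕ k + K) * (N + T)
        real-time k (_ , t₀≤ , s′ , t , run , t≤ , Qs′) = s′ , t , run , Qs′ , steps⇒time k t≤ t₀≤

        prepend : ∀ {q r} {Q : Store → Set q} {R : Store → Set r} {p p′ s} j k →
                  Halts p s (j ℕ.* n ^ 2) Q → (∀ {s′} → Q s′ → HaltsInTime p′ s′ k R) →
                  HaltsInTime (p ⨾ p′) s (j ℕ.+ k) R
        prepend j k (s₁ , t₁ , run₁ , t₁≤ , Qs₁) next with next Qs₁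
        ... | t , t≤ , s₂ , t₂ , run₂ , t₂≤ , Rs₂ =
          t , t≤ , s₂ , t₁ ℕ.+ t₂ , seq run₁ run₂ ,
          ℕ.≤-trans (ℕ.+-mono-≤ t₁≤ t₂≤) (ℕ.≤-reflexive
            (solve 4 (λ j k x t → j :* x :+ (k :* x :+ t) := (j :+ k) :* x :+ t)
               ≡.refl j k (n ^ 2) t)) ,
          Rs₂
          where open +-*-Solver

        append : ∀ {q r} {Q : Store → Set q} {R : Store → Set r} {p p′ s} j k →
                 HaltsInTime p s j Q → (∀ {s′} → Q s′ → Halts p′ s′ (k ℕ.* n ^ 2) R) →
                 HaltsInTime (p ⨾ p′) s (j ℕ.+ k) R
        append j k (t , t≤ , halts) next =
          t , t≤ , halts-weaken (ℕ.≤-reflexive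
            (solve 4 (λ j k x t → j :* x :+ t :+ k :* x := (j :+ k) :* x :+ t)
               ≡.refl j k (n ^ 2) t)) (λ Rs → Rs) (halts-seq halts next)
          where open +-*-Solver

        halts-demand-round : ∀ {s} → register s 0 ≡ n × Packed (array s) →
                             Halts (demand ⨾ fill 4 roundedEntry) s (42 ℕ.* n ^ 2)
                               λ s′ → ApproxTransport r c C ε (output s′ n)
        halts-demand-round {s} (n≡ , packed) =
          halts-weaken (ℕ.≤-reflexive (≡.sym (ℕ.*-distribʳ-+ (n ^ 2) 26 16))) (λ Rs → Rs)
            (halts-seq (halts-demand (array s) n≡ ≡.refl) (halts-round (array s) packed))

        haltsInTime-transport : ∀ {s} → register s 0 ≡ n → Input (array s) →
                                HaltsInTime transport s 87 λ s′ → ApproxTransport r c C ε (output s′ n)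
        haltsInTime-transport n≡ inputs =
          -- In each `prepend` the second number is the coefficient of n² left for the remaining
          -- phases: 10 + 15 + 12 + 8 + 42 = 87.
          prepend 10 77 (halts-clear n≡ inputs) λ (n≡ , cleared) →
          prepend 15 62 (halts-maximum n≡ cleared) λ (n≡ , measured) →
          prepend 12 50 (halts-complement n≡ measured) λ (n≡ , complemented) →
          append 8 42 (halts-pack n≡ complemented)
            halts-demand-round

      halts-transport : ∀ {s} → register s 0 ≡ n → Input (array s) →
        ∃ λ s′ → ∃ λ t → Run 𝒪 transport s t s′ × ApproxTransport r c C ε (output s′ n) ×
          fromℕ t ≤ (fromℕ 87 + max (proj₁ inTime) 0#) * (fromℕ (n ^ 2) + 𝒯 n n (‖ C ‖max / ε))
      halts-transport n≡ inputs = real-time 87 (haltsInTime-transport n≡ inputs)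

  -- An empty sum is 0, not 1. This is the source of n ≥ 1, on which every absorption of lower-order
  -- costs rests.
  simplex⇒nonZero : ∀ {n x} → Simplex n x → NonZero n
  simplex⇒nonZero {zero}  (_ , 0≈1) = contradiction 0≈1 0≉1
  simplex⇒nonZero {suc n} _         = _

theorem1 : ∀ {c ℓ₁ ℓ₂} (ℝ : Reals c ℓ₁ ℓ₂) → let open OptimalTransport ℝ in
    (𝒯 : ℕ → ℕ → Carrier → Carrier) → IsRunningTime 𝒯 →
    (𝒪 : Oracle) → SolvesPacking 𝒪 → RunsInTime 𝒪 𝒯 →
    ∃ λ (p : Program) →
    SolvesTransportInTime 𝒪 p (λ {n} C ε → fromℕ (n ^ 2) + 𝒯 n n (‖ C ‖max / ε))
theorem1 ℝ 𝒯 𝒯-runningTime 𝒪 solves inTime =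
  transport , fromℕ 87 + max (proj₁ inTime) 0# , λ r c C ε input s encodes →
    let open Encodes encodes
        instance n≢0 = simplex⇒nonZero (TransportInput.r∈Δ input)
    in halts-transport input 𝒯 𝒯-runningTime solves inTime n≡ (r≈ , c≈ , C≈ , ε≈)
  where
  open OptimalTransport ℝ
  open Transport ℝ 𝒪
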